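{- Let $p$ be a prime, $n$ a positive integer, $r\in\mathbb{Z}$, and let $r_0\in\mathbb{F}_p$ with $r\equiv r_0\pmod p$. (a) The polynomial $x^n-r_0$ is irreducible in $\mathbb{F}_p[x]$ if and only if the congruence $D^r_n(x_0,\ldots,x_{n-1})\equiv 0\pmod p$ has no non-trivial solution $(x_0,\ldots,x_{n-1})\in\mathbb{Z}^n$ (non-trivial meaning that not all $x_i$ are divisible by $p$). (b) If $x^n-r$ is reducible in $\mathbb{Q}[x]$, then $D^r_n(\bar x)=0$ has a solution $\bar x\in\mathbb{Z}^n$ with $\bar x\neq(0,\ldots,0)$. (c) If $n\geq 2$ and the congruence $x^n\equiv r\pmod p$ has a solution, then $D^r_n(x_0,\ldots,x_{n-1})\equiv 0\pmod p$ has a solution $(x_0,\ldots,x_{n-1})\in\mathbb{Z}^n$, not all $x_i$ zero, satisfying $-p^{1/n}<x_i<p^{1/n}$ for all $0\leq i<n$.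
   Context: For an integral domain $R$, $r\in R$, a positive integer $n$ and $\bar x=(x_0,\ldots,x_{n-1})\in R^n$, let $M^r_n(\bar x)$ be the $n\times n$ matrix whose $(i,j)$ entry ($0\le i,j<n$) is $x_{i-j}$ if $i\ge j$ and $r\,x_{n+i-j}$ if $i<j$; i.e. first column $(x_0,x_1,\ldots,x_{n-1})^T$, first row $(x_0, r x_{n-1}, r x_{n-2},\ldots, r x_1)$, each subsequent column being the cyclic downward shift of the previous one with the wrapped-around entry multiplied by $r$. Let $D^r_n(\bar x)=\det M^r_n(\bar x)$. (This is the norm of $x_0+x_1u+\cdots+x_{n-1}u^{n-1}$ in $R[x]/(x^n-r)$, $u=x \bmod (x^n-r)$; e.g. $D^r_2(x_0,x_1)=x_0^2-rx_1^2$.) -}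

module Defs where

open import Level using (0ℓ)
open import Data.Nat as ℕ using (ℕ; zero; suc; _≤_; _<_; _∸_; _≤?_; _<?_)
open import Data.Fin using (Fin; zero; suc; toℕ; fromℕ<; punchIn)
import Data.Integer as ℤ
open ℤ using (ℤ; +_)
open import Data.Integer.Divisibility using () renaming (_∣_ to _∣ℤ_)
open import Data.Product using (Σ; ∃; _×_)
open import Relation.Nullary using (¬_; yes; no)
open import Algebra.Bundles.Raw using (RawRing)
import Data.Rational as ℚ

sumFin : ∀ {n} → (Fin n → ℤ) → ℤ
sumFin {zero}  f = + 0
sumFin {suc n} f = f zero ℤ.+ sumFin (λ i → f (suc i))

sign : ℕ → ℤ
sign zero          = + 1
sign (suc zero)    = ℤ.- (+ 1)
sign (suc (suc k)) = sign k

det : ∀ n → (Fin n → Fin n → ℤ) → ℤ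
det zero    M = + 1
det (suc n) M =
  sumFin (λ j → sign (toℕ j) ℤ.* M zero j ℤ.* det n (λ i k → M (suc i) (punchIn j k)))

-- x_k for k < n (the value 0 for k ≥ n is never used)
at : ∀ {n} → (Fin n → ℤ) → ℕ → ℤ
at {n} x k with k <? n
... | yes k<n = x (fromℕ< k<n)
... | no  _   = + 0

Mat : (r : ℤ) (n : ℕ) → (Fin n → ℤ) → Fin n → Fin n → ℤ
Mat r n x i j with toℕ j ≤? toℕ i
... | yes _ = at x (toℕ i ∸ toℕ j)
... | no  _ = r ℤ.* at x ((n ℕ.+ toℕ i) ∸ toℕ j)

D : (r : ℤ) (n : ℕ) → (Fin n → ℤ) → ℤ
D r n x = det n (Mat r n x)

-- Polynomials over a (raw) ring, as coefficient sequences ℕ → Carrier.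

module Poly (R : RawRing 0ℓ 0ℓ) where
  open RawRing R

  convUpTo : (ℕ → Carrier) → (ℕ → Carrier) → ℕ → ℕ → Carrier
  convUpTo f g k zero    = f 0 * g k
  convUpTo f g k (suc m) = convUpTo f g k m + f (suc m) * g (k ∸ suc m)

  _·_ : (ℕ → Carrier) → (ℕ → Carrier) → ℕ → Carrier
  (f · g) k = convUpTo f g k k

  HasDegree : (ℕ → Carrier) → ℕ → Set
  HasDegree f d = (¬ (f d ≈ 0#)) × (∀ i → d < i → f i ≈ 0#)

  binom : ℕ → Carrier → ℕ → Carrier
  binom n c k with k ℕ.≟ n | k ℕ.≟ 0
  ... | yes _ | _     = 1#
  ... | no  _ | yes _ = - c
  ... | no  _ | no  _ = 0#

  BinomReducible : ℕ → Carrier → Set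
  BinomReducible n c =
    Σ (ℕ → Carrier) λ f → Σ (ℕ → Carrier) λ g → Σ ℕ λ d → Σ ℕ λ e →
      (1 ≤ d) × (1 ≤ e) × HasDegree f d × HasDegree g e ×
      (∀ k → (f · g) k ≈ binom n c k)

  -- irreducible: x^n - c (nonzero, non-unit for n ≥ 1) is not such a product
  BinomIrreducible : ℕ → Carrier → Set
  BinomIrreducible n c = ¬ BinomReducible n c

𝔽 : ℕ → RawRing 0ℓ 0ℓ
𝔽 p = record
  { Carrier = ℤ
  ; _≈_ = λ a b → (+ p) ∣ℤ (a ℤ.- b)
  ; _+_ = ℤ._+_
  ; _*_ = ℤ._*_
  ; -_ = ℤ.-_
  ; 0# = + 0
  ; 1# = + 1
  }

ℚring : RawRing 0ℓ 0ℓ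
ℚring = ℚ.+-*-rawRing

-- Over a field K, the columns of the matrix of x are the multiples x, u x, u² x, … of x in K[u] with uⁿ = r.
-- If xⁿ - r = f g, then g is annihilated by f, which gives a kernel vector, so D(g) = 0 by Cramer's rule; over ℚ one clears denominators.
-- If xⁿ - r is irreducible, Euclid's algorithm puts 1 into the ideal generated by x ≠ 0, so the rows of the matrix span Kⁿ
-- and a Laplace expansion shows by induction on n that its determinant is not 0.
-- If aⁿ = r, then (1, a, …, aⁿ⁻¹) is a left eigenvector with eigenvalue x(a), and the pigeonhole principle,
-- applied to the tuples with entries in {0, …, s}, where s = ⌊(p - 1)^(1/n)⌋, gives a small x with x(a) ≡ 0 mod p.
module Submission where

open import Defs
open import Data.Nat using (ℕ; _≤_; _<_)
open import Data.Nat.Primality using (Prime)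
open import Data.Fin using (Fin)
open import Data.Integer using (ℤ; +_)
open import Data.Integer.Divisibility using (_∣_)
open import Data.Product using (Σ; ∃; _×_)
open import Relation.Nullary using (¬_)
open import Relation.Binary.PropositionalEquality using (_≡_; _≢_)

open import Level using (0ℓ)
open import Algebra.Bundles using (CommutativeRing)
open import Algebra.Morphism.Structures using (IsRingHomomorphism)
import Algebra.Properties.Ring as RingProperties
import Algebra.Properties.Semiring.Exp as SemiringExp
import Algebra.Properties.Semiring.Sum as SemiringSum
import Algebra.Solver.Ring as RingSolver
open import Algebra.Solver.Ring.AlmostCommutativeRing using (AlmostCommutativeRing; fromCommutativeRing; _-Raw-AlmostCommutative⟶_)
open import Data.Fin using (zero; suc; toℕ; fromℕ<; opposite; punchIn; finToFun; funToFin; combine)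
open import Data.Fin.Permutation using (reverse)
open import Data.Fin.Properties using (opposite-prop; opposite-involutive; toℕ-fromℕ<; fromℕ<-toℕ; toℕ<n; toℕ-injective; pigeonhole; funToFin-finToFin; ¬∀⟶∃¬; <⇒≢)
import Data.Integer as ℤ
import Data.Integer.Properties as ℤₚ
open import Data.Integer.DivMod using (_%ℕ_; _/ℕ_; n%ℕd<d; a≡a%ℕn+[a/ℕn]*n)
import Data.Integer.Divisibility.Signed as Signed
open import Data.Integer.Tactic.RingSolver using (solve-∀)
open import Data.Maybe using (Maybe; just; nothing)
open import Data.Nat as ℕ using (zero; suc; z≤n; s≤s; _∸_; NonZero)
open import Data.Nat.Coprimality using (coprime-Bézout; Coprime)
import Data.Nat.Divisibility as ℕ∣
open import Data.Nat.GCD using (module Bézout)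
open import Data.Nat.Primality using (prime⇒irreducible; prime⇒nonZero; prime⇒nonTrivial)
import Data.Nat.Properties as ℕₚ
open import Data.Product using (_,_; proj₁; proj₂)
import Data.Rational as ℚ
import Data.Rational.Properties as ℚₚ
import Data.Rational.Unnormalised as ℚᵘ
import Data.Rational.Unnormalised.Properties as ℚᵘₚ
open import Data.Sum using (_⊎_; inj₁; inj₂; [_,_]′)
open import Data.Vec.Functional using (updateAt)
open import Data.Vec.Functional.Properties using (updateAt-updates; updateAt-minimal)
open import Function using (_∘_; const; id)
import Relation.Binary.PropositionalEquality as ≡
import Relation.Binary.Reasoning.Setoid as SetoidReasoning
open import Relation.Nullary using (yes; no; contradiction)

-- `det` is expanded along the top row, so linearity, alternation and Cramer's rule come out for
-- rows, and vectors multiply matrices from the left. The ring structure of K[u], however, sits in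
-- the columns. The symmetry of the matrix in its antidiagonal reconciles the two: a row read
-- backwards is again a power of u times x, so a left product with the coefficients of g in reverse
-- order is g(u) x read backwards. Evaluation at a root a, in contrast, fits the columns directly.
-- Everything is proved once for a field K with a homomorphism `ι` from the integers, and then
-- specialised to the residues mod p and to ℚ. In a factorisation f g only g is turned into a
-- matrix, so only g has to be scaled to integer coefficients; f keeps its coefficients in K.

sign-suc : ∀ k → sign (suc k) ≡ ℤ.- sign k
sign-suc zero          = ≡.refl
sign-suc (suc zero)    = ≡.refl
sign-suc (suc (suc k)) = sign-suc k

sign-square : ∀ k → sign k ℤ.* sign k ≡ + 1
sign-square zero          = ≡.refl
sign-square (suc zero)    = ≡.refl
sign-square (suc (suc k)) = sign-square k

-- The constructive form of a field: a zero test that returns an inverse when it fails, so that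
-- pivots and leading coefficients can be found by case analysis.
ZeroOrInvertible : CommutativeRing 0ℓ 0ℓ → Set
ZeroOrInvertible R = ∀ a → a ≈ 0# ⊎ (∃ λ b → b * a ≈ 1#)
  where open CommutativeRing R

Nontrivial : CommutativeRing 0ℓ 0ℓ → Set
Nontrivial R = ¬ 1# ≈ 0#
  where open CommutativeRing R

-- Determinants over a commutative ring: linearity, alternation and Cramer's rule for rows

module Determinant (R : CommutativeRing 0ℓ 0ℓ) (ι : ℤ → CommutativeRing.Carrier R)
  (ι-hom : IsRingHomomorphism ℤ.+-*-rawRing (CommutativeRing.rawRing R) ι) where

  open CommutativeRing R hiding (zero)
  open IsRingHomomorphism ι-hom using () renaming (+-homo to ι-+; *-homo to ι-*; -‿homo to ι-neg; 0#-homo to ι-0; 1#-homo to ι-1)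
  open SemiringSum semiring using (sum; sum-cong-≋; ∑-distrib-+; *-distribˡ-sum; sum-replicate-zero; sum-remove)
  open RingProperties ring using (-‿distribˡ-*; -0#≈0#)
  open SetoidReasoning setoid

  private
    acr : AlmostCommutativeRing 0ℓ 0ℓ
    acr = fromCommutativeRing R

    ι-morphism : ℤ.+-*-rawRing -Raw-AlmostCommutative⟶ acr
    ι-morphism = record { ⟦_⟧ = ι ; +-homo = ι-+ ; *-homo = ι-* ; -‿homo = ι-neg ; 0-homo = ι-0 ; 1-homo = ι-1 }

    ι-≟ : ∀ a b → Maybe (ι a ≈ ι b)
    ι-≟ a b with a ℤₚ.≟ b
    ... | yes ≡.refl = just refl
    ... | no  _      = nothing

  open RingSolver ℤ.+-*-rawRing acr ι-morphism ι-≟ public using (solve; _:=_; _:+_; _:*_; :-_; _:-_)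

  Vector : ℕ → Set
  Vector n = Fin n → Carrier

  Matrix : ℕ → Set
  Matrix n = Fin n → Vector n

  infixl 8 _[_≔_]
  _[_≔_] : ∀ {m n} → (Fin m → Vector n) → Fin m → Vector n → Fin m → Vector n
  M [ k ≔ u ] = updateAt M k (const u)

  ε : ℕ → Carrier
  ε k = ι (sign k)

  ε-suc : ∀ k → ε (suc k) ≈ - ε k
  ε-suc k = trans (reflexive (≡.cong ι (sign-suc k))) (ι-neg (sign k))

  ε-square : ∀ k → ε k * ε k ≈ 1#
  ε-square k = trans (sym (ι-* (sign k) (sign k))) (trans (reflexive (≡.cong ι (sign-square k))) ι-1)

  minor : ∀ {n} → Fin (suc n) → Matrix (suc n) → Matrix n
  minor j M i l = M (suc i) (punchIn j l)

  Det : ∀ n → Matrix n → Carrier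
  Det zero    M = 1#
  Det (suc n) M = sum (λ j → ε (toℕ j) * M zero j * Det n (minor j M))

  ι-sumFin : ∀ {n} (f : Fin n → ℤ) → ι (sumFin f) ≈ sum (ι ∘ f)
  ι-sumFin {zero}  f = ι-0
  ι-sumFin {suc n} f = trans (ι-+ (f zero) (sumFin (f ∘ suc))) (+-congˡ (ι-sumFin (f ∘ suc)))

  ι-det : ∀ n (M : Fin n → Fin n → ℤ) → ι (det n M) ≈ Det n (λ i j → ι (M i j))
  ι-det zero    M = ι-1
  ι-det (suc n) M = trans (ι-sumFin term) (sum-cong-≋ ι-term)
    where
    N : Fin (suc n) → Fin n → Fin n → ℤ
    N j i l = M (suc i) (punchIn j l)
    term : Fin (suc n) → ℤ
    term j = sign (toℕ j) ℤ.* M zero j ℤ.* det n (N j)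
    ι-term : ∀ j → ι (term j) ≈ ε (toℕ j) * ι (M zero j) * Det n (λ i l → ι (N j i l))
    ι-term j = trans (ι-* (sign (toℕ j) ℤ.* M zero j) (det n (N j))) (*-cong (ι-* (sign (toℕ j)) (M zero j)) (ι-det n (N j)))

  sum-0 : ∀ {n} {f : Vector n} → (∀ i → f i ≈ 0#) → sum f ≈ 0#
  sum-0 {n} f≈0 = trans (sum-cong-≋ f≈0) (sum-replicate-zero n)

  sum-single : ∀ {n} (k : Fin n) {f : Vector n} → (∀ i → i ≢ k → f i ≈ 0#) → sum f ≈ f k
  sum-single zero    f≈0 = trans (+-congˡ (sum-0 (λ i → f≈0 (suc i) λ ()))) (+-identityʳ _)
  sum-single (suc k) {f} f≈0 = trans
    (+-cong (f≈0 zero λ ()) (sum-single k {f ∘ suc} (λ i i≢k → f≈0 (suc i) λ { ≡.refl → i≢k ≡.refl })))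
    (+-identityˡ _)

  sum-neg : ∀ {n} (f : Vector n) → sum (λ i → - f i) ≈ - sum f
  sum-neg {zero}  f = sym -0#≈0#
  sum-neg {suc n} f = trans (+-congˡ (sum-neg (f ∘ suc))) (solve 2 (λ a b → :- a :+ :- b := :- (a :+ b)) refl _ _)

  Det-cong : ∀ n {M N : Matrix n} → (∀ i j → M i j ≈ N i j) → Det n M ≈ Det n N
  Det-cong zero    M≈N = refl
  Det-cong (suc n) {M} {N} M≈N = sum-cong-≋ step
    where
    step : ∀ j → ε (toℕ j) * M zero j * Det n (minor j M) ≈ ε (toℕ j) * N zero j * Det n (minor j N)
    step j = *-cong (*-congˡ (M≈N zero j)) (Det-cong n (λ i l → M≈N (suc i) (punchIn j l)))

  ≔-cong : ∀ {m n} {M : Fin m → Vector n} {u v : Vector n} k → (∀ j → u j ≈ v j) →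
           ∀ i j → (M [ k ≔ u ]) i j ≈ (M [ k ≔ v ]) i j
  ≔-cong zero    u≈v zero    j = u≈v j
  ≔-cong zero    u≈v (suc i) j = refl
  ≔-cong (suc k) u≈v zero    j = refl
  ≔-cong (suc k) u≈v (suc i) j = ≔-cong k u≈v i j

  ≔-self : ∀ {m n} {M : Fin m → Vector n} {u : Vector n} k → (∀ j → u j ≈ M k j) →
           ∀ i j → (M [ k ≔ u ]) i j ≈ M i j
  ≔-self zero    u≈ zero    j = u≈ j
  ≔-self zero    u≈ (suc i) j = refl
  ≔-self (suc k) u≈ zero    j = refl
  ≔-self (suc k) u≈ (suc i) j = ≔-self k u≈ i j

  ≔-reindex : ∀ {m n l} (φ : Fin l → Fin n) (M : Fin m → Vector n) (u : Vector n) k i j →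
              (M [ k ≔ u ]) i (φ j) ≈ ((λ i → M i ∘ φ) [ k ≔ u ∘ φ ]) i j
  ≔-reindex φ M u zero    zero    j = refl
  ≔-reindex φ M u zero    (suc i) j = refl
  ≔-reindex φ M u (suc k) zero    j = refl
  ≔-reindex φ M u (suc k) (suc i) j = ≔-reindex φ (M ∘ suc) u k i j

  Det-minor-≔ : ∀ n (M : Matrix (suc n)) k u j →
                Det n (minor j (M [ suc k ≔ u ])) ≈ Det n (minor j M [ k ≔ u ∘ punchIn j ])
  Det-minor-≔ n M k u j = Det-cong n (≔-reindex (punchIn j) (M ∘ suc) u k)

  -- Additivity and homogeneity in one induction. If `k` is the top row, the minors do not see the
  -- change; otherwise only the minors see it, and the induction hypothesis applies to them.
  Det-linear : ∀ n (M : Matrix n) k (u w : Vector n) c →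
               Det n (M [ k ≔ (λ j → u j + c * w j) ]) ≈ Det n (M [ k ≔ u ]) + c * Det n (M [ k ≔ w ])
  Det-linear (suc n) M k u w c = begin
    sum (X k z)                             ≈⟨ sum-cong-≋ (step k) ⟩
    sum (λ j → X k u j + c * X k w j)       ≈⟨ ∑-distrib-+ (X k u) (λ j → c * X k w j) ⟩
    sum (X k u) + sum (λ j → c * X k w j)   ≈⟨ +-congˡ (*-distribˡ-sum c (X k w)) ⟨
    sum (X k u) + c * sum (X k w)           ∎
    where
    z : Vector (suc n)
    z j = u j + c * w j
    X : Fin (suc n) → Vector (suc n) → Vector (suc n)
    X k v j = ε (toℕ j) * (M [ k ≔ v ]) zero j * Det n (minor j (M [ k ≔ v ]))
    step : ∀ k j → X k z j ≈ X k u j + c * X k w j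
    step zero    j = solve 5 (λ s a b c d → s :* (a :+ c :* b) :* d := s :* a :* d :+ c :* (s :* b :* d)) refl
      (ε (toℕ j)) (u j) (w j) c (Det n (minor j M))
    step (suc k) j = begin
      s * Det n (minor j (M [ suc k ≔ z ]))
        ≈⟨ *-congˡ (Det-minor-≔ n M k z j) ⟩
      s * Det n (minor j M [ k ≔ z ∘ punchIn j ])
        ≈⟨ *-congˡ (Det-linear n (minor j M) k (u ∘ punchIn j) (w ∘ punchIn j) c) ⟩
      s * (Det n (minor j M [ k ≔ u ∘ punchIn j ]) + c * Det n (minor j M [ k ≔ w ∘ punchIn j ]))
        ≈⟨ *-congˡ (+-cong (Det-minor-≔ n M k u j) (*-congˡ (Det-minor-≔ n M k w j))) ⟨
      s * (Det n (minor j (M [ suc k ≔ u ])) + c * Det n (minor j (M [ suc k ≔ w ])))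
        ≈⟨ solve 4 (λ s d e c → s :* (d :+ c :* e) := s :* d :+ c :* (s :* e)) refl s _ _ c ⟩
      X (suc k) u j + c * X (suc k) w j ∎
      where
      s : Carrier
      s = ε (toℕ j) * M zero j

  -- A zero row equals `u + (- 1#) * u`, so linearity turns the determinant into the difference of
  -- two equal terms.
  Det-zeroRow : ∀ n (M : Matrix n) k {u : Vector n} → (∀ j → u j ≈ 0#) → Det n (M [ k ≔ u ]) ≈ 0#
  Det-zeroRow n M k {u} u≈0 = begin
    Det n (M [ k ≔ u ])                                        ≈⟨ Det-cong n (≔-cong k u≈u-u) ⟩
    Det n (M [ k ≔ (λ j → u j + (- 1#) * u j) ])               ≈⟨ Det-linear n M k u u (- 1#) ⟩
    Det n (M [ k ≔ u ]) + (- 1#) * Det n (M [ k ≔ u ])         ≈⟨ -1*-cancel _ ⟩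
    0#                                                         ∎
    where
    -1*-cancel : ∀ a → a + (- 1#) * a ≈ 0#
    -1*-cancel a = trans (+-congˡ (trans (sym (-‿distribˡ-* 1# a)) (-‿cong (*-identityˡ a)))) (-‿inverseʳ a)
    u≈u-u : ∀ j → u j ≈ u j + (- 1#) * u j
    u≈u-u j = trans (u≈0 j) (sym (-1*-cancel (u j)))

  Det-sum : ∀ {l} n (M : Matrix n) k (c : Vector l) (A : Fin l → Vector n) →
            Det n (M [ k ≔ (λ j → sum (λ i → c i * A i j)) ]) ≈ sum (λ i → c i * Det n (M [ k ≔ A i ]))
  Det-sum {zero}  n M k c A = Det-zeroRow n M k (λ _ → refl)
  Det-sum {suc l} n M k c A = begin
    Det n (M [ k ≔ (λ j → c zero * A zero j + sum (λ i → c (suc i) * A (suc i) j)) ])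
      ≈⟨ Det-cong n (≔-cong k (λ j → +-comm _ _)) ⟩
    Det n (M [ k ≔ (λ j → sum (λ i → c (suc i) * A (suc i) j) + c zero * A zero j) ])
      ≈⟨ Det-linear n M k _ (A zero) (c zero) ⟩
    Det n (M [ k ≔ (λ j → sum (λ i → c (suc i) * A (suc i) j)) ]) + c zero * Det n (M [ k ≔ A zero ])
      ≈⟨ +-comm _ _ ⟩
    c zero * Det n (M [ k ≔ A zero ]) + Det n (M [ k ≔ (λ j → sum (λ i → c (suc i) * A (suc i) j)) ])
      ≈⟨ +-congˡ (Det-sum n M k (c ∘ suc) (A ∘ suc)) ⟩
    sum (λ i → c i * Det n (M [ k ≔ A i ])) ∎

  -- When both removed columns are positive, column 0 survives: `punchIn (suc j) ∘ punchIn (suc k)`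
  -- agrees pointwise with `extend (punchIn j ∘ punchIn k)`.
  extend : ∀ {m n} → (Fin m → Fin n) → Fin (suc m) → Fin (suc n)
  extend φ zero    = zero
  extend φ (suc l) = suc (φ l)

  double-laplace : ∀ n (G : Fin (2 ℕ.+ n) → Fin (2 ℕ.+ n) → (Fin n → Fin (2 ℕ.+ n)) → Carrier) →
    (∀ a b φ ψ → (∀ l → φ l ≡ ψ l) → G a b φ ≈ G b a ψ) →
    sum (λ j → sum (λ k → ε (toℕ j) * ε (toℕ k) * G j (punchIn j k) (punchIn j ∘ punchIn k))) ≈ 0#
  -- The terms (0, k) and (k + 1, 0) remove the same two columns with opposite signs; the rest is a smaller sum of the same shape.
  double-laplace n G G-sym = begin
    sum top + sum (λ j → left j + sum (inner j))
      ≈⟨ +-congˡ (∑-distrib-+ left (λ j → sum (inner j))) ⟩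
    sum top + (sum left + sum (λ j → sum (inner j)))
      ≈⟨ +-congˡ (+-cong (trans (sum-cong-≋ left≈-top) (sum-neg top)) (remainder n G G-sym)) ⟩
    sum top + (- sum top + 0#)
      ≈⟨ +-congˡ (+-identityʳ _) ⟩
    sum top - sum top
      ≈⟨ -‿inverseʳ _ ⟩
    0# ∎
    where
    top left : Vector (suc n)
    top k = ε 0 * ε (toℕ k) * G zero (suc k) (suc ∘ punchIn k)
    left j = ε (suc (toℕ j)) * ε 0 * G (suc j) zero (punchIn (suc j) ∘ suc)
    inner : Fin (suc n) → Vector n
    inner j k = ε (suc (toℕ j)) * ε (suc (toℕ k)) * G (suc j) (suc (punchIn j k)) (punchIn (suc j) ∘ punchIn (suc k))
    left≈-top : ∀ j → left j ≈ - top j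
    left≈-top j = trans
      (*-cong (*-congʳ (ε-suc (toℕ j))) (G-sym (suc j) zero _ (suc ∘ punchIn j) (λ _ → ≡.refl)))
      (solve 3 (λ a b c → :- a :* b :* c := :- (b :* a :* c)) refl (ε (toℕ j)) (ε 0) (G zero (suc j) (suc ∘ punchIn j)))
    remainder : ∀ n (G : Fin (2 ℕ.+ n) → Fin (2 ℕ.+ n) → (Fin n → Fin (2 ℕ.+ n)) → Carrier) →
      (∀ a b φ ψ → (∀ l → φ l ≡ ψ l) → G a b φ ≈ G b a ψ) →
      sum (λ j → sum (λ k → ε (suc (toℕ j)) * ε (suc (toℕ k)) * G (suc j) (suc (punchIn j k)) (punchIn (suc j) ∘ punchIn (suc k)))) ≈ 0#
    remainder zero    G G-sym = +-identityˡ 0#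
    remainder (suc n) G G-sym = trans
      (sum-cong-≋ (λ j → sum-cong-≋ (step j)))
      (double-laplace n H (λ a b φ ψ φ≗ψ → G-sym (suc a) (suc b) (extend φ) (extend ψ) (λ { zero → ≡.refl ; (suc l) → ≡.cong suc (φ≗ψ l) })))
      where
      H : Fin (2 ℕ.+ n) → Fin (2 ℕ.+ n) → (Fin n → Fin (2 ℕ.+ n)) → Carrier
      H a b φ = G (suc a) (suc b) (extend φ)
      step : ∀ j k → ε (suc (toℕ j)) * ε (suc (toℕ k)) * G (suc j) (suc (punchIn j k)) (punchIn (suc j) ∘ punchIn (suc k))
                   ≈ ε (toℕ j) * ε (toℕ k) * H j (punchIn j k) (punchIn j ∘ punchIn k)
      step j k = *-cong
        (trans (*-cong (ε-suc (toℕ j)) (ε-suc (toℕ k))) (solve 2 (λ a b → :- a :* :- b := a :* b) refl (ε (toℕ j)) (ε (toℕ k))))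
        -- `G-sym` is the only congruence available in the column embedding, so `φ` is replaced by
        -- `ψ` by swapping the two columns and swapping them back.
        (trans (G-sym (suc j) b φ ψ (λ { zero → ≡.refl ; (suc l) → ≡.refl })) (G-sym b (suc j) ψ ψ (λ _ → ≡.refl)))
        where
        b = suc (punchIn j k)
        φ = punchIn (suc j) ∘ punchIn (suc k)
        ψ = extend (punchIn j ∘ punchIn k)

  Alternating : ∀ n → Fin n → Fin n → Set
  Alternating n a b = ∀ M → (∀ j → M a j ≈ M b j) → Det n M ≈ 0#

  -- Expanding along both rows gives a signed sum over ordered pairs of columns. Equality of the
  -- rows makes the unsigned part `G` symmetric in the pair, so the terms cancel in
  -- `double-laplace`.
  alternating-01 : ∀ n → Alternating (2 ℕ.+ n) zero (suc zero)
  alternating-01 n M M₀≈M₁ = trans (sum-cong-≋ expand) (double-laplace n G G-sym)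
    where
    G : Fin (2 ℕ.+ n) → Fin (2 ℕ.+ n) → (Fin n → Fin (2 ℕ.+ n)) → Carrier
    G a b φ = M zero a * M (suc zero) b * Det n (λ i l → M (suc (suc i)) (φ l))
    G-sym : ∀ a b φ ψ → (∀ l → φ l ≡ ψ l) → G a b φ ≈ G b a ψ
    G-sym a b φ ψ φ≗ψ = *-cong
      (trans (*-comm _ _) (*-cong (sym (M₀≈M₁ b)) (M₀≈M₁ a)))
      (Det-cong n (λ i l → reflexive (≡.cong (M (suc (suc i))) (φ≗ψ l))))
    inner : Fin (2 ℕ.+ n) → Vector (suc n)
    inner j k = ε (toℕ k) * M (suc zero) (punchIn j k) * Det n (minor k (minor j M))
    expand : ∀ j → ε (toℕ j) * M zero j * sum (inner j) ≈
                   sum (λ k → ε (toℕ j) * ε (toℕ k) * G j (punchIn j k) (punchIn j ∘ punchIn k))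
    expand j = trans (*-distribˡ-sum (ε (toℕ j) * M zero j) (inner j)) (sum-cong-≋ regroup)
      where
      regroup : ∀ k → ε (toℕ j) * M zero j * inner j k ≈ ε (toℕ j) * ε (toℕ k) * G j (punchIn j k) (punchIn j ∘ punchIn k)
      regroup k = solve 5 (λ s m t n d → s :* m :* (t :* n :* d) := s :* t :* (m :* n :* d)) refl
        (ε (toℕ j)) (M zero j) (ε (toℕ k)) (M (suc zero) (punchIn j k)) (Det n (minor k (minor j M)))

  ≔-comm : ∀ {m n} {M : Fin m → Vector n} {x y : Vector n} {a b : Fin m} → a ≢ b →
           ∀ i j → (M [ a ≔ x ] [ b ≔ y ]) i j ≈ (M [ b ≔ y ] [ a ≔ x ]) i j
  ≔-comm {a = zero}  {zero}  a≢b i       j = contradiction ≡.refl a≢b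
  ≔-comm {a = zero}  {suc b} a≢b zero    j = refl
  ≔-comm {a = zero}  {suc b} a≢b (suc i) j = refl
  ≔-comm {a = suc a} {zero}  a≢b zero    j = refl
  ≔-comm {a = suc a} {zero}  a≢b (suc i) j = refl
  ≔-comm {a = suc a} {suc b} a≢b zero    j = refl
  ≔-comm {a = suc a} {suc b} a≢b (suc i) j = ≔-comm {a = a} {b} (a≢b ∘ ≡.cong suc) i j

  Det-add : ∀ n (M : Matrix n) k (u w : Vector n) →
            Det n (M [ k ≔ (λ j → u j + w j) ]) ≈ Det n (M [ k ≔ u ]) + Det n (M [ k ≔ w ])
  Det-add n M k u w = begin
    Det n (M [ k ≔ (λ j → u j + w j) ])           ≈⟨ Det-cong n (≔-cong k (λ j → +-congˡ (sym (*-identityˡ (w j))))) ⟩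
    Det n (M [ k ≔ (λ j → u j + 1# * w j) ])      ≈⟨ Det-linear n M k u w 1# ⟩
    Det n (M [ k ≔ u ]) + 1# * Det n (M [ k ≔ w ]) ≈⟨ +-congˡ (*-identityˡ _) ⟩
    Det n (M [ k ≔ u ]) + Det n (M [ k ≔ w ])     ∎

  -- Polarisation: `F` is bilinear and vanishes at `(x , x)`, `(y , y)` and `(x ⊕ y , x ⊕ y)`, which
  -- leaves `F x y + F y x ≈ 0#`.
  alternating⇒antisymmetric : ∀ n {a b} → a ≢ b → Alternating n a b → ∀ M x y →
    Det n (M [ a ≔ x ] [ b ≔ y ]) ≈ - Det n (M [ a ≔ y ] [ b ≔ x ])
  alternating⇒antisymmetric n {a} {b} a≢b alt M x y = begin
    F x y                                          ≈⟨ cancel _ _ ⟩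
    F x y + F y x - F y x                          ≈⟨ +-congʳ (+-cong (trans (sym (+-identityˡ _)) (+-congʳ (sym (F-diag x)))) (trans (sym (+-identityʳ _)) (+-congˡ (sym (F-diag y))))) ⟩
    (F x x + F x y) + (F y x + F y y) - F y x      ≈⟨ +-congʳ (+-cong (F-addʳ x x y) (F-addʳ y x y)) ⟨
    F x (x ⊕ y) + F y (x ⊕ y) - F y x              ≈⟨ +-congʳ (F-addˡ x y (x ⊕ y)) ⟨
    F (x ⊕ y) (x ⊕ y) - F y x                      ≈⟨ +-congʳ (F-diag (x ⊕ y)) ⟩
    0# - F y x                                     ≈⟨ +-identityˡ _ ⟩
    - F y x                                        ∎
    where
    F : Vector n → Vector n → Carrier
    F u v = Det n (M [ a ≔ u ] [ b ≔ v ])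
    _⊕_ : Vector n → Vector n → Vector n
    (u ⊕ v) j = u j + v j
    cancel : ∀ s t → s ≈ s + t - t
    cancel = solve 2 (λ s t → s := s :+ t :- t) refl
    F-addʳ : ∀ u v w → F u (v ⊕ w) ≈ F u v + F u w
    F-addʳ u v w = Det-add n (M [ a ≔ u ]) b v w
    F-addˡ : ∀ u v w → F (u ⊕ v) w ≈ F u w + F v w
    F-addˡ u v w = trans (Det-cong n (≔-comm a≢b)) (trans (Det-add n (M [ b ≔ w ]) a u v)
      (sym (+-cong (Det-cong n (≔-comm a≢b)) (Det-cong n (≔-comm a≢b)))))
    F-diag : ∀ u → F u u ≈ 0#
    F-diag u = alt (M [ a ≔ u ] [ b ≔ u ]) λ j → reflexive (≡.cong-app (≡.trans
      (≡.trans (updateAt-minimal a b (M [ a ≔ u ]) a≢b) (updateAt-updates a M))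
      (≡.sym (updateAt-updates b (M [ a ≔ u ])))) j)

  -- Mutual induction on the size. Two rows below the top one are still equal in every minor. If the
  -- top row is involved, its partner is swapped into row 1, where `alternating-01` applies; the
  -- swap concerns lower rows only, so its antisymmetry rests on smaller determinants.
  Det-alternating : ∀ n {a b} → a ≢ b → Alternating n a b
  alternating-suc : ∀ n {a b} → a ≢ b → Alternating (suc n) (suc a) (suc b)
  alternating-0   : ∀ n b → Alternating (suc n) zero (suc b)

  Det-alternating (suc n) {zero}  {zero}  a≢b M eq = contradiction ≡.refl a≢b
  Det-alternating (suc n) {suc a} {suc b} a≢b M eq = alternating-suc n (a≢b ∘ ≡.cong suc) M eq
  Det-alternating (suc n) {suc a} {zero}  a≢b M eq = alternating-0 n a M (sym ∘ eq)
  Det-alternating (suc n) {zero}  {suc b} a≢b M eq = alternating-0 n b M eq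

  alternating-suc n {a} {b} a≢b M eq = sum-0 term≈0
    where
    term≈0 : ∀ j → ε (toℕ j) * M zero j * Det n (minor j M) ≈ 0#
    term≈0 j = trans (*-congˡ (Det-alternating n a≢b (minor j M) (λ l → eq (punchIn j l)))) (zeroʳ _)

  alternating-0 (suc n) zero    M eq = alternating-01 n M eq
  alternating-0 (suc n) (suc b) M eq = begin
    Det (2 ℕ.+ n) M
      ≈⟨ Det-cong (2 ℕ.+ n) unchanged ⟨
    Det (2 ℕ.+ n) (M [ suc zero ≔ M (suc zero) ] [ c ≔ M c ])
      ≈⟨ alternating⇒antisymmetric (2 ℕ.+ n) {suc zero} {c} (λ ()) (alternating-suc (suc n) λ ()) M (M (suc zero)) (M c) ⟩
    - Det (2 ℕ.+ n) (M [ suc zero ≔ M c ] [ c ≔ M (suc zero) ])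
      ≈⟨ -‿cong (alternating-01 n (M [ suc zero ≔ M c ] [ c ≔ M (suc zero) ]) eq) ⟩
    - 0#
      ≈⟨ -0#≈0# ⟩
    0# ∎
    where
    c : Fin (2 ℕ.+ n)
    c = suc (suc b)
    unchanged : ∀ i j → (M [ suc zero ≔ M (suc zero) ] [ c ≔ M c ]) i j ≈ M i j
    unchanged i j = trans (≔-self {M = M [ suc zero ≔ M (suc zero) ]} c (λ _ → refl) i j)
                          (≔-self {M = M} (suc zero) (λ _ → refl) i j)

  _ᵀ*_ : ∀ {m n} → Vector m → (Fin m → Vector n) → Vector n
  (v ᵀ* M) j = sum (λ i → v i * M i j)

  -- The new row is a combination of the rows of `M`; by linearity the determinant splits, and every
  -- term except the one for row `k` has a repeated row.
  cramer : ∀ n (M : Matrix n) (v w : Vector n) → (∀ j → (v ᵀ* M) j ≈ w j) →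
           ∀ k → Det n (M [ k ≔ w ]) ≈ v k * Det n M
  cramer n M v w vM≈w k = begin
    Det n (M [ k ≔ w ])                         ≈⟨ Det-cong n (≔-cong k (sym ∘ vM≈w)) ⟩
    Det n (M [ k ≔ v ᵀ* M ])                    ≈⟨ Det-sum n M k v M ⟩
    sum (λ i → v i * Det n (M [ k ≔ M i ]))     ≈⟨ sum-single k vanish ⟩
    v k * Det n (M [ k ≔ M k ])                 ≈⟨ *-congˡ (Det-cong n (≔-self k (λ _ → refl))) ⟩
    v k * Det n M                               ∎
    where
    vanish : ∀ i → i ≢ k → v i * Det n (M [ k ≔ M i ]) ≈ 0#
    vanish i i≢k = trans (*-congˡ (Det-alternating n i≢k (M [ k ≔ M i ]) λ j → reflexive (≡.cong-app
      (≡.trans (updateAt-minimal i k M i≢k) (≡.sym (updateAt-updates k M))) j))) (zeroʳ _)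

  e₀ : ∀ {n} → Vector n
  e₀ zero    = 1#
  e₀ (suc _) = 0#

  -- An expansion along row `k` derived from expansions along the top row: the minor that omits
  -- column 0 acquires a zero row, while every other minor contains a shorter `e₀`, to which the
  -- induction applies.
  Det-≔-e₀ : ∀ n (M : Matrix (suc n)) k →
             Det (suc n) (M [ k ≔ e₀ ]) ≈ ε (toℕ k) * Det n (λ i l → M (punchIn k i) (suc l))
  Det-≔-e₀ n       M zero    = trans (sum-single zero vanish) (*-congʳ (*-identityʳ _))
    where
    vanish : ∀ i → i ≢ zero → ε (toℕ i) * e₀ i * Det n (minor i (M [ zero ≔ e₀ ])) ≈ 0#
    vanish zero    i≢0 = contradiction ≡.refl i≢0
    vanish (suc i) i≢0 = trans (*-congʳ (zeroʳ _)) (zeroˡ _)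
  Det-≔-e₀ (suc n) M (suc k) = begin
    ε 0 * M zero zero * Det (suc n) (minor zero N) + sum (λ j → term (suc j))
      ≈⟨ +-cong (trans (*-congˡ (trans (Det-minor-≔ (suc n) M k e₀ zero) (Det-zeroRow (suc n) (minor zero M) k (λ _ → refl)))) (zeroʳ _))
                (sum-cong-≋ step) ⟩
    0# + sum (λ j → ε (suc (toℕ k)) * term′ j)
      ≈⟨ trans (+-identityˡ _) (sym (*-distribˡ-sum (ε (suc (toℕ k))) term′)) ⟩
    ε (suc (toℕ k)) * sum term′ ∎
    where
    N : Matrix (2 ℕ.+ n)
    N = M [ suc k ≔ e₀ ]
    term : Vector (2 ℕ.+ n)
    term j = ε (toℕ j) * M zero j * Det (suc n) (minor j N)
    Q : Fin (suc n) → Matrix n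
    Q j i l = M (suc (punchIn k i)) (suc (punchIn j l))
    term′ : Vector (suc n)
    term′ j = ε (toℕ j) * M zero (suc j) * Det n (Q j)
    step : ∀ j → term (suc j) ≈ ε (suc (toℕ k)) * term′ j
    step j = begin
      ε (suc (toℕ j)) * M zero (suc j) * Det (suc n) (minor (suc j) N)
        ≈⟨ *-congˡ (trans (Det-minor-≔ (suc n) M k e₀ (suc j))
             (Det-cong (suc n) (≔-cong k (λ { zero → refl ; (suc l) → refl })))) ⟩
      ε (suc (toℕ j)) * M zero (suc j) * Det (suc n) (minor (suc j) M [ k ≔ e₀ ])
        ≈⟨ *-cong (*-congʳ (ε-suc (toℕ j))) (Det-≔-e₀ n (minor (suc j) M) k) ⟩
      - ε (toℕ j) * M zero (suc j) * (ε (toℕ k) * Det n (Q j))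
        ≈⟨ solve 4 (λ s m t d → :- s :* m :* (t :* d) := :- t :* (s :* m :* d)) refl (ε (toℕ j)) (M zero (suc j)) (ε (toℕ k)) (Det n (Q j)) ⟩
      - ε (toℕ k) * term′ j
        ≈⟨ *-congʳ (ε-suc (toℕ k)) ⟨
      ε (suc (toℕ k)) * term′ j ∎

  -- Vanishing and non-vanishing of determinants over a field

  module Field (inverse : ZeroOrInvertible R) (1≉0 : Nontrivial R) where

    unit⇒≉0 : ∀ {a b} → b * a ≈ 1# → ¬ a ≈ 0#
    unit⇒≉0 ba≈1 a≈0 = 1≉0 (trans (sym ba≈1) (trans (*-congˡ a≈0) (zeroʳ _)))

    unit-cancel : ∀ {a b c} → b * a ≈ 1# → a * c ≈ 0# → c ≈ 0#
    unit-cancel {a} {b} {c} ba≈1 ac≈0 = begin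
      c             ≈⟨ *-identityˡ c ⟨
      1# * c        ≈⟨ *-congʳ ba≈1 ⟨
      b * a * c     ≈⟨ *-assoc b a c ⟩
      b * (a * c)   ≈⟨ *-congˡ ac≈0 ⟩
      b * 0#        ≈⟨ zeroʳ b ⟩
      0#            ∎

    ≉0⇒unit : ∀ {a} → ¬ a ≈ 0# → ∃ λ b → b * a ≈ 1#
    ≉0⇒unit {a} a≉0 with inverse a
    ... | inj₁ a≈0  = contradiction a≈0 a≉0
    ... | inj₂ unit = unit

    allZero⊎unit : ∀ {n} (v : Vector n) → (∀ i → v i ≈ 0#) ⊎ (∃ λ i → ∃ λ b → b * v i ≈ 1#)
    allZero⊎unit {zero}  v = inj₁ λ ()
    allZero⊎unit {suc n} v with inverse (v zero) | allZero⊎unit (v ∘ suc)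
    ... | inj₂ unit | _               = inj₂ (zero , unit)
    ... | inj₁ _    | inj₂ (i , unit) = inj₂ (suc i , unit)
    ... | inj₁ v₀≈0 | inj₁ v≈0        = inj₁ λ { zero → v₀≈0 ; (suc i) → v≈0 i }

    kernel⇒Det≈0 : ∀ n (M : Matrix n) (v : Vector n) → (∀ j → (v ᵀ* M) j ≈ 0#) → ∀ k → ¬ v k ≈ 0# → Det n M ≈ 0#
    kernel⇒Det≈0 n M v vM≈0 k vₖ≉0 =
      unit-cancel (proj₂ (≉0⇒unit vₖ≉0)) (trans (sym (cramer n M v (λ _ → 0#) vM≈0 k)) (Det-zeroRow n M k (λ _ → refl)))

    -- Solvability of all systems is the hypothesis because it descends to a minor. If `v ᵀ* M` is
    -- `e₀` and `v k` is a unit, then by Cramer's rule a vanishing `Det M` forces the minor `N`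
    -- without row `k` and column 0 to vanish as well, and `N` again solves every system.
    surjective⇒Det≉0 : ∀ n (M : Matrix n) → ((w : Vector n) → ∃ λ (v : Vector n) → ∀ j → (v ᵀ* M) j ≈ w j) → ¬ Det n M ≈ 0#
    surjective⇒Det≉0 zero    M surj = 1≉0
    surjective⇒Det≉0 (suc n) M surj D≈0 with surj e₀
    ... | v , vM≈e₀ with allZero⊎unit v
    ...   | inj₁ v≈0 = 1≉0 (trans (sym (vM≈e₀ zero)) (sum-0 {suc n} (λ i → trans (*-congʳ (v≈0 i)) (zeroˡ (M i zero)))))
    ...   | inj₂ (k , b , bvₖ≈1) = surjective⇒Det≉0 n N N-surj DN≈0
      where
      N : Matrix n
      N i l = M (punchIn k i) (suc l)
      DN≈0 : Det n N ≈ 0#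
      DN≈0 = unit-cancel (ε-square (toℕ k)) (trans (sym (Det-≔-e₀ n M k))
        (trans (cramer (suc n) M v e₀ vM≈e₀ k) (trans (*-congˡ D≈0) (zeroʳ _))))
      N-surj : (w : Vector n) → ∃ λ (u : Vector n) → ∀ j → (u ᵀ* N) j ≈ w j
      N-surj w with surj (λ { zero → 0# ; (suc l) → w l })
      ... | y , yM≈w = z ∘ punchIn k , λ j → begin
        sum (λ i → z (punchIn k i) * M (punchIn k i) (suc j))     ≈⟨ +-identityˡ _ ⟨
        0# + sum (λ i → z (punchIn k i) * M (punchIn k i) (suc j)) ≈⟨ +-congʳ (trans (*-congʳ zₖ≈0) (zeroˡ _)) ⟨
        z k * M k (suc j) + sum (λ i → z (punchIn k i) * M (punchIn k i) (suc j)) ≈⟨ sum-remove {i = k} (λ i → z i * M i (suc j)) ⟨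
        sum (λ i → z i * M i (suc j))                             ≈⟨ sum-cong-≋ (split j) ⟩
        sum (λ i → y i * M i (suc j) + c * (v i * M i (suc j)))   ≈⟨ ∑-distrib-+ (λ i → y i * M i (suc j)) (λ i → c * (v i * M i (suc j))) ⟩
        (y ᵀ* M) (suc j) + sum (λ i → c * (v i * M i (suc j)))    ≈⟨ +-cong (yM≈w (suc j)) (sym (*-distribˡ-sum c (λ i → v i * M i (suc j)))) ⟩
        w j + c * (v ᵀ* M) (suc j)                                ≈⟨ +-congˡ (trans (*-congˡ (vM≈e₀ (suc j))) (zeroʳ c)) ⟩
        w j + 0#                                                  ≈⟨ +-identityʳ (w j) ⟩
        w j                                                       ∎
        where
        -- Adding `c * v` to the solution `y` cancels its coefficient at row `k`, so that only rows
        -- of `N` remain. Since `v ᵀ* M` is `e₀`, the product changes in column 0 only, which `N`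
        -- omits.
        c : Carrier
        c = - (y k * b)
        z : Vector (suc n)
        z i = y i + c * v i
        zₖ≈0 : z k ≈ 0#
        zₖ≈0 = begin
          y k + c * v k              ≈⟨ solve 3 (λ y b v → y :+ :- (y :* b) :* v := y :- y :* (b :* v)) refl (y k) b (v k) ⟩
          y k - y k * (b * v k)      ≈⟨ +-congˡ (-‿cong (trans (*-congˡ bvₖ≈1) (*-identityʳ _))) ⟩
          y k - y k                  ≈⟨ -‿inverseʳ _ ⟩
          0#                         ∎
        split : ∀ j i → z i * M i (suc j) ≈ y i * M i (suc j) + c * (v i * M i (suc j))
        split j i = solve 4 (λ y c v m → (y :+ c :* v) :* m := y :* m :+ c :* (v :* m)) refl (y i) c (v i) (M i (suc j))

-- Matrix indices under reflection in the antidiagonal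

reflect-∸ : ∀ {i j k} → i ≤ k → i ∸ j ≡ k ∸ j ∸ (k ∸ i)
reflect-∸ {i} {j} {k} i≤k = begin
  i ∸ j                 ≡⟨ ≡.cong (_∸ j) (ℕₚ.m∸[m∸n]≡n i≤k) ⟨
  k ∸ (k ∸ i) ∸ j       ≡⟨ ℕₚ.∸-+-assoc k (k ∸ i) j ⟩
  k ∸ (k ∸ i ℕ.+ j)     ≡⟨ ≡.cong (k ∸_) (ℕₚ.+-comm (k ∸ i) j) ⟩
  k ∸ (j ℕ.+ (k ∸ i))   ≡⟨ ℕₚ.∸-+-assoc k j (k ∸ i) ⟨
  k ∸ j ∸ (k ∸ i)       ∎
  where open ≡.≡-Reasoning

-- The reflection takes (i, j) to (k - j, k - i) and preserves i - j. This is the version for the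
-- wrapped index above the diagonal, where `suc k` is added before truncated subtraction.
reflect-wrap : ∀ {i j k} → i ≤ k → j ≤ k → suc k ℕ.+ i ∸ j ≡ suc k ℕ.+ (k ∸ j) ∸ (k ∸ i)
reflect-wrap {i} {j} {k} i≤k j≤k = ≡.sym (begin
  suc k ℕ.+ (k ∸ j) ∸ (k ∸ i)                     ≡⟨ ≡.cong (λ t → suc t ℕ.+ (k ∸ j) ∸ (k ∸ i)) (ℕₚ.m∸n+n≡m i≤k) ⟨
  suc (k ∸ i ℕ.+ i) ℕ.+ (k ∸ j) ∸ (k ∸ i)         ≡⟨ ≡.cong (_∸ (k ∸ i)) (≡.trans (≡.cong suc (ℕₚ.+-assoc (k ∸ i) i (k ∸ j))) (≡.sym (ℕₚ.+-suc (k ∸ i) (i ℕ.+ (k ∸ j))))) ⟩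
  k ∸ i ℕ.+ suc (i ℕ.+ (k ∸ j)) ∸ (k ∸ i)         ≡⟨ ℕₚ.m+n∸m≡n (k ∸ i) _ ⟩
  suc i ℕ.+ (k ∸ j)                               ≡⟨ ℕₚ.+-∸-assoc (suc i) j≤k ⟨
  suc i ℕ.+ k ∸ j                                 ≡⟨ ≡.cong (λ t → suc t ∸ j) (ℕₚ.+-comm i k) ⟩
  suc k ℕ.+ i ∸ j                                 ∎)
  where open ≡.≡-Reasoning

-- Polynomials as coefficient sequences: products, division, and the quotient by x^n - r

module Polynomials (R : CommutativeRing 0ℓ 0ℓ) (ι : ℤ → CommutativeRing.Carrier R)
  (ι-hom : IsRingHomomorphism ℤ.+-*-rawRing (CommutativeRing.rawRing R) ι) where

  open CommutativeRing R hiding (zero)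
  open Determinant R ι ι-hom
  open Poly rawRing
  open SemiringSum semiring using (sum; sum-cong-≋; *-distribˡ-sum; sum-permute)
  open SetoidReasoning setoid

  Below : ℕ → (ℕ → Carrier) → Set
  Below L f = ∀ i → L ≤ i → f i ≈ 0#

  binom-top : ∀ n c → binom n c n ≈ 1#
  binom-top n c with n ℕ.≟ n
  ... | yes _   = refl
  ... | no  n≢n = contradiction ≡.refl n≢n

  binom-bottom : ∀ k c → binom (suc k) c 0 ≈ - c
  binom-bottom k c = refl

  binom-other : ∀ n c i → i ≢ n → i ≢ 0 → binom n c i ≈ 0#
  binom-other n c i i≢n i≢0 with i ℕ.≟ n | i ℕ.≟ 0
  ... | yes i≡n | _       = contradiction i≡n i≢n
  ... | no  _   | yes i≡0 = contradiction i≡0 i≢0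
  ... | no  _   | no  _   = refl

  binom-cong : ∀ n {b c} → b ≈ c → ∀ i → binom n b i ≈ binom n c i
  binom-cong n b≈c i with i ℕ.≟ n | i ℕ.≟ 0
  ... | yes _ | _     = refl
  ... | no  _ | yes _ = -‿cong b≈c
  ... | no  _ | no  _ = refl

  -- `convUpTo` splits off its last summand; splitting off the first one instead makes a product
  -- recursive in its left factor, f g = f(0) g + x (f' g) with f' the tail of f.
  convUpTo-suc : ∀ f g i m → convUpTo f g (suc i) (suc m) ≈ f 0 * g (suc i) + convUpTo (f ∘ suc) g i m
  convUpTo-suc f g i zero    = refl
  convUpTo-suc f g i (suc m) = trans (+-congʳ (convUpTo-suc f g i m)) (+-assoc _ _ _)

  conv-suc : ∀ f g i → (f · g) (suc i) ≈ f 0 * g (suc i) + ((f ∘ suc) · g) i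
  conv-suc f g i = convUpTo-suc f g i i

  conv-zeroˡ : ∀ f g → (∀ i → f i ≈ 0#) → ∀ i → (f · g) i ≈ 0#
  conv-zeroˡ f g f≈0 zero    = trans (*-congʳ (f≈0 0)) (zeroˡ _)
  conv-zeroˡ f g f≈0 (suc i) = begin
    (f · g) (suc i)                         ≈⟨ conv-suc f g i ⟩
    f 0 * g (suc i) + ((f ∘ suc) · g) i     ≈⟨ +-cong (trans (*-congʳ (f≈0 0)) (zeroˡ _)) (conv-zeroˡ (f ∘ suc) g (f≈0 ∘ suc) i) ⟩
    0# + 0#                                 ≈⟨ +-identityˡ 0# ⟩
    0#                                      ∎

  -- The bound is exclusive for `f` and inclusive for `g`: the induction on `L` then ends at the
  -- zero polynomial, and the bounds add without a subtraction.
  conv-below : ∀ L d f g → Below L f → Below (suc d) g → Below (L ℕ.+ d) (f · g)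
  conv-below zero    d f g f-below g-below i       _           = conv-zeroˡ f g (λ j → f-below j z≤n) i
  conv-below (suc L) d f g f-below g-below (suc i) (s≤s L+d≤i) = begin
    (f · g) (suc i)                         ≈⟨ conv-suc f g i ⟩
    f 0 * g (suc i) + ((f ∘ suc) · g) i     ≈⟨ +-cong (trans (*-congˡ (g-below (suc i) (s≤s (ℕₚ.≤-trans (ℕₚ.m≤n+m d L) L+d≤i)))) (zeroʳ _))
                                                      (conv-below L d (f ∘ suc) g (λ j L≤j → f-below (suc j) (s≤s L≤j)) g-below i L+d≤i) ⟩
    0# + 0#                                 ≈⟨ +-identityˡ 0# ⟩
    0#                                      ∎

  conv-top : ∀ d e f g → Below (suc d) f → Below (suc e) g → (f · g) (d ℕ.+ e) ≈ f d * g e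
  conv-top zero    zero    f g f-below g-below = refl
  conv-top zero    (suc e) f g f-below g-below = begin
    (f · g) (suc e)                         ≈⟨ conv-suc f g e ⟩
    f 0 * g (suc e) + ((f ∘ suc) · g) e     ≈⟨ +-congˡ (conv-zeroˡ (f ∘ suc) g (λ i → f-below (suc i) (s≤s z≤n)) e) ⟩
    f 0 * g (suc e) + 0#                    ≈⟨ +-identityʳ _ ⟩
    f 0 * g (suc e)                         ∎
  conv-top (suc d) e f g f-below g-below = begin
    (f · g) (suc (d ℕ.+ e))                 ≈⟨ conv-suc f g (d ℕ.+ e) ⟩
    f 0 * g (suc (d ℕ.+ e)) + ((f ∘ suc) · g) (d ℕ.+ e)
      ≈⟨ +-cong (trans (*-congˡ (g-below _ (s≤s (ℕₚ.m≤n+m e d)))) (zeroʳ _)) (conv-top d e (f ∘ suc) g (λ i d<i → f-below (suc i) (s≤s d<i)) g-below) ⟩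
    0# + f (suc d) * g e                    ≈⟨ +-identityˡ _ ⟩
    f (suc d) * g e                         ∎

  conv-scaleʳ : ∀ c f g h → (∀ i → h i ≈ c * g i) → ∀ i → (f · h) i ≈ c * (f · g) i
  conv-scaleʳ c f g h h≈cg i = go i
    where
    term : ∀ j → f j * h (i ∸ j) ≈ c * (f j * g (i ∸ j))
    term j = trans (*-congˡ (h≈cg (i ∸ j))) (solve 3 (λ f c g → f :* (c :* g) := c :* (f :* g)) refl (f j) c (g (i ∸ j)))
    go : ∀ m → convUpTo f h i m ≈ c * convUpTo f g i m
    go zero    = term 0
    go (suc m) = trans (+-cong (go m) (term (suc m))) (sym (distribˡ c _ _))

  infixr 5 _◂_
  _◂_ : Carrier → (ℕ → Carrier) → ℕ → Carrier
  (c ◂ f) zero    = c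
  (c ◂ f) (suc i) = f i

  -- Synthetic division, by recursion on the tail of `f`. Multiplying the tail's remainder by x
  -- raises its degree to at most `suc d`, the degree of `y`; the new constant coefficient `c` of
  -- the quotient is chosen to cancel the term of that degree.
  divide : ∀ d y {b} → b * y (suc d) ≈ 1# → Below (suc (suc d)) y →
           ∀ L f → Below (L ℕ.+ suc d) f →
           ∃ λ q → Below L q × Below (suc d) (λ i → f i - (q · y) i)
  divide d y bu≈1 y-below zero f f-below = const 0# , (λ _ _ → refl) , λ i d<i →
    trans (+-cong (f-below i d<i) (-‿cong (conv-zeroˡ (const 0#) y (λ _ → refl) i))) (-‿inverseʳ 0#)
  divide d y {b} bu≈1 y-below (suc L) f f-below
    with divide d y bu≈1 y-below L (f ∘ suc) (λ i L+d≤i → f-below (suc i) (s≤s L+d≤i))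
  ... | q , q-below , rem-below = c ◂ q , (λ { (suc i) (s≤s L≤i) → q-below i L≤i }) , below
    where
    rem : ℕ → Carrier
    rem i = f (suc i) - (q · y) i
    c : Carrier
    c = rem d * b
    step : ∀ i → f (suc i) - ((c ◂ q) · y) (suc i) ≈ rem i - c * y (suc i)
    step i = trans (+-congˡ (-‿cong (conv-suc (c ◂ q) y i)))
      (solve 3 (λ f a b → f :- (a :+ b) := f :- b :- a) refl (f (suc i)) (c * y (suc i)) ((q · y) i))
    below : Below (suc d) (λ i → f i - ((c ◂ q) · y) i)
    below (suc i) (s≤s d≤i) with ℕₚ.m≤n⇒m<n∨m≡n d≤i
    ... | inj₁ d<i = begin
      f (suc i) - ((c ◂ q) · y) (suc i)   ≈⟨ step i ⟩
      rem i - c * y (suc i)               ≈⟨ +-cong (rem-below i d<i) (-‿cong (trans (*-congˡ (y-below (suc i) (s≤s d<i))) (zeroʳ c))) ⟩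
      0# - 0#                             ≈⟨ -‿inverseʳ 0# ⟩
      0#                                  ∎
    ... | inj₂ ≡.refl = begin
      f (suc i) - ((c ◂ q) · y) (suc i)   ≈⟨ step i ⟩
      rem i - rem i * b * y (suc i)       ≈⟨ +-congˡ (-‿cong (trans (*-assoc _ _ _) (trans (*-congˡ bu≈1) (*-identityʳ _)))) ⟩
      rem i - rem i                       ≈⟨ -‿inverseʳ _ ⟩
      0#                                  ∎

  -- R[u] with u ^ (k + 1) = r: a residue is represented by a sequence, of which only the entries 0, …, k matter.
  module Quotient (r : Carrier) (k : ℕ) where

    infix 4 _≈ᵏ_
    _≈ᵏ_ : (ℕ → Carrier) → (ℕ → Carrier) → Set
    y ≈ᵏ z = ∀ l → l ≤ k → y l ≈ z l

    -- Multiplication by u: the top coefficient would move to u ^ (k + 1) and re-enters at 0 with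
    -- the factor `r`.
    U : (ℕ → Carrier) → ℕ → Carrier
    U y zero    = r * y k
    U y (suc l) = y l

    U^ : ℕ → (ℕ → Carrier) → ℕ → Carrier
    U^ zero    y = y
    U^ (suc j) y = U (U^ j y)

    U-cong : ∀ {y z} → y ≈ᵏ z → U y ≈ᵏ U z
    U-cong y≈z zero    _           = *-congˡ (y≈z k ℕₚ.≤-refl)
    U-cong y≈z (suc l) sl≤k = y≈z l (ℕₚ.<⇒≤ sl≤k)

    U^-shift : ∀ j y l → j ≤ l → U^ j y l ≈ y (l ∸ j)
    U^-shift zero    y l       _         = refl
    U^-shift (suc j) y (suc l) (s≤s j≤l) = U^-shift j y l j≤l

    -- With `U^-shift` this yields the two cases in the definition of `Mat`. The bound admits
    -- `j = suc k`, which is past the last column but is the relation u ^ (k + 1) = r used in `U^n`.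
    U^-wrap : ∀ j y l → l < j → j ≤ suc k → U^ j y l ≈ r * y ((suc k ℕ.+ l) ∸ j)
    U^-wrap (suc j) y zero    _         (s≤s j≤k) = *-congˡ
      (trans (U^-shift j y k j≤k) (reflexive (≡.cong (λ t → y (t ∸ j)) (≡.sym (ℕₚ.+-identityʳ k)))))
    U^-wrap (suc j) y (suc l) (s≤s l<j) (s≤s j≤k) =
      trans (U^-wrap j y l l<j (ℕₚ.m≤n⇒m≤1+n j≤k)) (*-congˡ (reflexive (≡.cong (λ t → y (t ∸ j)) (≡.sym (ℕₚ.+-suc k l)))))

    circ : (ℕ → Carrier) → Matrix (suc k)
    circ y i j = U^ (toℕ j) y (toℕ i)

    -- Reflecting circ y in its antidiagonal changes nothing, so its rows, read backwards, are again powers of u times y.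
    U^-reflect : ∀ y {i j} → i ≤ k → j ≤ k → U^ j y i ≈ U^ (k ∸ i) y (k ∸ j)
    U^-reflect y {i} {j} i≤k j≤k with j ℕ.≤? i
    ... | yes j≤i = begin
      U^ j y i                        ≈⟨ U^-shift j y i j≤i ⟩
      y (i ∸ j)                       ≡⟨ ≡.cong y (reflect-∸ {j = j} i≤k) ⟩
      y (k ∸ j ∸ (k ∸ i))             ≈⟨ U^-shift (k ∸ i) y (k ∸ j) (ℕₚ.∸-monoʳ-≤ k j≤i) ⟨
      U^ (k ∸ i) y (k ∸ j)            ∎
    ... | no j≰i = begin
      U^ j y i                        ≈⟨ U^-wrap j y i (ℕₚ.≰⇒> j≰i) (ℕₚ.m≤n⇒m≤1+n j≤k) ⟩
      r * y (suc k ℕ.+ i ∸ j)         ≡⟨ ≡.cong (λ t → r * y t) (reflect-wrap i≤k j≤k) ⟩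
      r * y (suc k ℕ.+ (k ∸ j) ∸ (k ∸ i)) ≈⟨ U^-wrap (k ∸ i) y (k ∸ j) (ℕₚ.∸-monoʳ-< (ℕₚ.≰⇒> j≰i) j≤k) (ℕₚ.≤-trans (ℕₚ.m∸n≤m k i) (ℕₚ.n≤1+n k)) ⟨
      U^ (k ∸ i) y (k ∸ j)            ∎

    -- Horner evaluation of (g₀ + g₁ u + … + g_{L-1} u ^ (L-1)) y.
    H : ℕ → (ℕ → Carrier) → (ℕ → Carrier) → ℕ → Carrier
    H zero    g y l = 0#
    H (suc L) g y l = g 0 * y l + U (H L (g ∘ suc) y) l

    H-sum : ∀ L g y l → H L g y l ≈ sum {L} (λ i → g (toℕ i) * U^ (toℕ i) y l)
    H-sum zero    g y l       = refl
    H-sum (suc L) g y (suc l) = +-congˡ (H-sum L (g ∘ suc) y l)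
    H-sum (suc L) g y zero    = +-congˡ (begin
      r * H L (g ∘ suc) y k     ≈⟨ *-congˡ (H-sum L (g ∘ suc) y k) ⟩
      r * sum term              ≈⟨ *-distribˡ-sum r term ⟩
      sum (λ i → r * term i)    ≈⟨ sum-cong-≋ move ⟩
      sum {L} (λ i → g (suc (toℕ i)) * (r * U^ (toℕ i) y k)) ∎)
      where
      term : Vector L
      term i = g (suc (toℕ i)) * U^ (toℕ i) y k
      move : ∀ i → r * term i ≈ g (suc (toℕ i)) * (r * U^ (toℕ i) y k)
      move i = solve 3 (λ r g y → r :* (g :* y) := g :* (r :* y)) refl r (g (suc (toℕ i))) (U^ (toℕ i) y k)

    reversed : (ℕ → Carrier) → Vector (suc k)
    reversed g i = g (k ∸ toℕ i)

    -- Translates row combinations into ring multiplication. By `U^-reflect`, row `i` read backwards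
    -- is u ^ (k - i) y, which `reversed g` weights with the coefficient of that same power.
    circ-H : ∀ g y j → (reversed g ᵀ* circ y) j ≈ H (suc k) g y (k ∸ toℕ j)
    circ-H g y j = begin
      (reversed g ᵀ* circ y) j     ≈⟨ sum-cong-≋ {suc k} unreverse ⟩
      sum (term ∘ opposite)        ≈⟨ sum-permute term reverse ⟨
      sum term                     ≈⟨ H-sum (suc k) g y l ⟨
      H (suc k) g y l              ∎
      where
      l : ℕ
      l = k ∸ toℕ j
      term : Vector (suc k)
      term i = g (toℕ i) * U^ (toℕ i) y l
      unreverse : ∀ i → reversed g i * circ y i j ≈ term (opposite i)
      unreverse i = trans (*-congˡ (U^-reflect y (ℕₚ.≤-pred (toℕ<n i)) (ℕₚ.≤-pred (toℕ<n j))))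
        (reflexive (≡.cong (λ t → g t * U^ t y l) (≡.sym (opposite-prop i))))

    H-zeroˡ : ∀ L g y → (∀ i → g i ≈ 0#) → ∀ l → H L g y l ≈ 0#
    H-zeroˡ zero    g y g≈0 l       = refl
    H-zeroˡ (suc L) g y g≈0 zero    = trans (+-cong (trans (*-congʳ (g≈0 0)) (zeroˡ _)) (trans (*-congˡ (H-zeroˡ L (g ∘ suc) y (g≈0 ∘ suc) k)) (zeroʳ r))) (+-identityˡ 0#)
    H-zeroˡ (suc L) g y g≈0 (suc l) = trans (+-cong (trans (*-congʳ (g≈0 0)) (zeroˡ _)) (H-zeroˡ L (g ∘ suc) y (g≈0 ∘ suc) l)) (+-identityˡ 0#)

    H-pad : ∀ {L L′} g y → L ≤ L′ → Below L g → ∀ l → H L′ g y l ≈ H L g y l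
    H-pad {L′ = L′} g y z≤n        g-below l       = H-zeroˡ L′ g y (λ i → g-below i z≤n) l
    H-pad           g y (s≤s L≤L′) g-below zero    = +-congˡ (*-congˡ (H-pad (g ∘ suc) y L≤L′ (λ i L≤i → g-below (suc i) (s≤s L≤i)) k))
    H-pad           g y (s≤s L≤L′) g-below (suc l) = +-congˡ (H-pad (g ∘ suc) y L≤L′ (λ i L≤i → g-below (suc i) (s≤s L≤i)) l)

    -- The product has degree at most `k`, so nothing wraps around: the coefficient that `U` would
    -- carry to position 0 is zero by `conv-below`.
    H-conv : ∀ L d g y → L ℕ.+ d ≤ suc k → Below L g → Below (suc d) y → ∀ l → H L g y l ≈ (g · y) l
    H-conv zero    d g y _           g-below y-below l = sym (conv-zeroˡ g y (λ i → g-below i z≤n) l)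
    H-conv (suc L) d g y (s≤s L+d≤k) g-below y-below zero = begin
      g 0 * y 0 + r * H L (g ∘ suc) y k   ≈⟨ +-congˡ (*-congˡ (trans
        (H-conv L d (g ∘ suc) y (ℕₚ.m≤n⇒m≤1+n L+d≤k) tail-below y-below k)
        (conv-below L d (g ∘ suc) y tail-below y-below k L+d≤k))) ⟩
      g 0 * y 0 + r * 0#                  ≈⟨ trans (+-congˡ (zeroʳ r)) (+-identityʳ _) ⟩
      g 0 * y 0                           ∎
      where
      tail-below : Below L (g ∘ suc)
      tail-below i L≤i = g-below (suc i) (s≤s L≤i)
    H-conv (suc L) d g y (s≤s L+d≤k) g-below y-below (suc l) = trans
      (+-congˡ (H-conv L d (g ∘ suc) y (ℕₚ.m≤n⇒m≤1+n L+d≤k) (λ i L≤i → g-below (suc i) (s≤s L≤i)) y-below l))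
      (sym (conv-suc g y l))

    -- A product of degree at most k + 1 is reduced by wrapping its top coefficient around once.
    H-reduce : ∀ e d g y → 1 ≤ e → e ℕ.+ d ≡ suc k → Below (suc e) g → Below (suc d) y → ∀ p → (∀ i → (g · y) i ≈ p i) →
               ∀ l → H (suc e) g y l ≈ (p 0 + r * p (suc k) ◂ p ∘ suc) l
    H-reduce e d g y 1≤e e+d≡n g-below y-below p gy≈p (suc l) = begin
      g 0 * y (suc l) + H e (g ∘ suc) y l     ≈⟨ +-congˡ (H-conv e d (g ∘ suc) y (ℕₚ.≤-reflexive e+d≡n) (λ i e≤i → g-below (suc i) (s≤s e≤i)) y-below l) ⟩
      g 0 * y (suc l) + ((g ∘ suc) · y) l     ≈⟨ conv-suc g y l ⟨
      (g · y) (suc l)                         ≈⟨ gy≈p (suc l) ⟩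
      p (suc l)                               ∎
    H-reduce e d g y 1≤e e+d≡n g-below y-below p gy≈p zero = +-cong (gy≈p 0) (*-congˡ (begin
      H e (g ∘ suc) y k                       ≈⟨ H-conv e d (g ∘ suc) y (ℕₚ.≤-reflexive e+d≡n) (λ i e≤i → g-below (suc i) (s≤s e≤i)) y-below k ⟩
      ((g ∘ suc) · y) k                       ≈⟨ +-identityˡ _ ⟨
      0# + ((g ∘ suc) · y) k                  ≈⟨ +-congʳ (trans (*-congˡ (y-below (suc k) d<n)) (zeroʳ (g 0))) ⟨
      g 0 * y (suc k) + ((g ∘ suc) · y) k     ≈⟨ conv-suc g y k ⟨
      (g · y) (suc k)                         ≈⟨ gy≈p (suc k) ⟩
      p (suc k)                               ∎))
      where
      d<n : d < suc k
      d<n = ≡.subst (d <_) e+d≡n (ℕₚ.+-monoˡ-≤ d 1≤e)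

    H-linear : ∀ L g h c y l → H L (λ i → g i + c * h i) y l ≈ H L g y l + c * H L h y l
    H-linear zero    g h c y l       = sym (trans (+-identityˡ _) (zeroʳ c))
    H-linear (suc L) g h c y (suc l) = trans (+-congˡ (H-linear L (g ∘ suc) (h ∘ suc) c y l))
      (solve 6 (λ g h c y s t → (g :+ c :* h) :* y :+ (s :+ c :* t) := g :* y :+ s :+ c :* (h :* y :+ t)) refl (g 0) (h 0) c (y (suc l)) _ _)
    H-linear (suc L) g h c y zero    = trans (+-congˡ (*-congˡ (H-linear L (g ∘ suc) (h ∘ suc) c y k)))
      (solve 7 (λ g h c y s t r → (g :+ c :* h) :* y :+ r :* (s :+ c :* t) := g :* y :+ r :* s :+ c :* (h :* y :+ r :* t)) refl (g 0) (h 0) c (y 0) _ _ r)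

    H-snoc : ∀ L g y l → H (suc L) g y l ≈ H L g y l + g L * U^ L y l
    H-snoc zero    g y zero    = trans (+-congˡ (zeroʳ r)) (+-comm _ 0#)
    H-snoc zero    g y (suc l) = +-comm _ 0#
    H-snoc (suc L) g y (suc l) = trans (+-congˡ (H-snoc L (g ∘ suc) y l)) (sym (+-assoc _ _ _))
    H-snoc (suc L) g y zero    = trans (+-congˡ (*-congˡ (H-snoc L (g ∘ suc) y k)))
      (solve 5 (λ a r s g u → a :+ r :* (s :+ g :* u) := a :+ r :* s :+ g :* (r :* u)) refl (g 0 * y 0) r _ (g (suc L)) _)

    U^n : ∀ y → U^ (suc k) y ≈ᵏ (λ l → r * y l)
    U^n y l l≤k = trans (U^-wrap (suc k) y l (s≤s l≤k) ℕₚ.≤-refl) (*-congˡ (reflexive (≡.cong y (ℕₚ.m+n∸m≡n k l))))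

    Ideal : (ℕ → Carrier) → (ℕ → Carrier) → Set
    Ideal x y = ∃ λ g → H (suc k) g x ≈ᵏ y

    module _ {x : ℕ → Carrier} where

      Ideal-resp : ∀ {y z} → y ≈ᵏ z → Ideal x y → Ideal x z
      Ideal-resp y≈z (g , gx≈y) = g , λ l l≤k → trans (gx≈y l l≤k) (y≈z l l≤k)

      Ideal-linear : ∀ {y z} c → Ideal x y → Ideal x z → Ideal x (λ l → y l + c * z l)
      Ideal-linear c (g , gx≈y) (h , hx≈z) = (λ i → g i + c * h i) , λ l l≤k →
        trans (H-linear (suc k) g h c x l) (+-cong (gx≈y l l≤k) (*-congˡ (hx≈z l l≤k)))

      Ideal-0 : Ideal x (const 0#)
      Ideal-0 = const 0# , λ l _ → H-zeroˡ (suc k) (const 0#) x (λ _ → refl) l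

      Ideal-scale : ∀ {y} c → Ideal x y → Ideal x (λ l → c * y l)
      Ideal-scale c y∈I = Ideal-resp (λ l _ → +-identityˡ _) (Ideal-linear c Ideal-0 y∈I)

      Ideal-U : ∀ {y} → Ideal x y → Ideal x (U y)
      -- The witness consists of the coefficients of u g, the top one re-entering at 0. The chain
      -- evaluates `H` on `0# ◂ g` with one extra term in two ways: by unfolding it is
      -- `U (H (suc k) g x)`, and `H-snoc` isolates the summand with u ^ (k + 1), which `U^n`
      -- replaces by `r`.
      Ideal-U {y} (g , gx≈y) = (r * g k ◂ g) , λ l l≤k → begin
        r * g k * x l + U (H k g x) l               ≈⟨ +-comm _ _ ⟩
        U (H k g x) l + r * g k * x l               ≈⟨ +-congˡ (solve 3 (λ r g x → r :* g :* x := g :* (r :* x)) refl r (g k) (x l)) ⟩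
        U (H k g x) l + g k * (r * x l)             ≈⟨ +-congˡ (*-congˡ (U^n x l l≤k)) ⟨
        U (H k g x) l + g k * U^ (suc k) x l        ≈⟨ +-congʳ (trans (+-congʳ (zeroˡ (x l))) (+-identityˡ _)) ⟨
        H (suc k) (0# ◂ g) x l + g k * U^ (suc k) x l ≈⟨ H-snoc (suc k) (0# ◂ g) x l ⟨
        0# * x l + U (H (suc k) g x) l              ≈⟨ trans (+-congʳ (zeroˡ (x l))) (+-identityˡ _) ⟩
        U (H (suc k) g x) l                         ≈⟨ U-cong gx≈y l l≤k ⟩
        U y l                                       ∎

      Ideal-H : ∀ L g {y} → Ideal x y → Ideal x (H L g y)
      Ideal-H zero    g     y∈I = Ideal-0
      Ideal-H (suc L) g {y} y∈I = Ideal-resp (λ l _ → +-comm _ _)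
        (Ideal-linear (g 0) (Ideal-U (Ideal-H L (g ∘ suc) y∈I)) y∈I)

    one : ℕ → Carrier
    one = 1# ◂ const 0#

    H-one : ∀ L g l → L ≤ suc k → Below L g → H L g one l ≈ g l
    H-one zero    g l       L≤n       g-below = sym (g-below l z≤n)
    H-one (suc L) g zero    (s≤s L≤k) g-below = begin
      g 0 * 1# + r * H L (g ∘ suc) one k    ≈⟨ +-cong (*-identityʳ (g 0)) (*-congˡ (H-one L (g ∘ suc) k (ℕₚ.m≤n⇒m≤1+n L≤k) (λ i L≤i → g-below (suc i) (s≤s L≤i)))) ⟩
      g 0 + r * g (suc k)                   ≈⟨ +-congˡ (trans (*-congˡ (g-below (suc k) (s≤s L≤k))) (zeroʳ r)) ⟩
      g 0 + 0#                              ≈⟨ +-identityʳ (g 0) ⟩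
      g 0                                   ∎
    H-one (suc L) g (suc l) (s≤s L≤k) g-below = begin
      g 0 * 0# + H L (g ∘ suc) one l        ≈⟨ +-cong (zeroʳ (g 0)) (H-one L (g ∘ suc) l (ℕₚ.m≤n⇒m≤1+n L≤k) (λ i L≤i → g-below (suc i) (s≤s L≤i))) ⟩
      0# + g (suc l)                        ≈⟨ +-identityˡ _ ⟩
      g (suc l)                             ∎

at-toℕ : ∀ {n} (x : Fin n → ℤ) i → at x (toℕ i) ≡ x i
at-toℕ {n} x i with toℕ i ℕ.<? n
... | yes i<n = ≡.cong x (fromℕ<-toℕ i i<n)
... | no  i≮n = contradiction (toℕ<n i) i≮n

at-≥ : ∀ {n} (x : Fin n → ℤ) l → n ≤ l → at x l ≡ + 0
at-≥ {n} x l n≤l with l ℕ.<? n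
... | yes l<n = contradiction n≤l (ℕₚ.<⇒≱ l<n)
... | no  _   = ≡.refl

-- Zeros of the determinant form over a field, by factorisation, irreducibility and roots

module Criteria (R : CommutativeRing 0ℓ 0ℓ) (ι : ℤ → CommutativeRing.Carrier R)
  (ι-hom : IsRingHomomorphism ℤ.+-*-rawRing (CommutativeRing.rawRing R) ι)
  (inverse : ZeroOrInvertible R) (1≉0 : Nontrivial R) where

  open CommutativeRing R hiding (zero)
  open Determinant R ι ι-hom
  open Field inverse 1≉0
  open Poly rawRing
  open Polynomials R ι ι-hom
  open RingProperties ring using (-0#≈0#; x∙y⁻¹≈ε⇒x≈y)
  open SemiringSum semiring using (sum; sum-cong-≋; ∑-distrib-+; *-distribˡ-sum)
  open SemiringExp semiring using (_^_)
  open IsRingHomomorphism ι-hom using () renaming (+-homo to ι-+; *-homo to ι-*; -‿homo to ι-neg; 0#-homo to ι-0)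
  open SetoidReasoning setoid

  fromVector : ∀ {n} → Vector n → ℕ → Carrier
  fromVector {zero}  v l       = 0#
  fromVector {suc n} v zero    = v zero
  fromVector {suc n} v (suc l) = fromVector (v ∘ suc) l

  fromVector-toℕ : ∀ {n} (v : Vector n) i → fromVector v (toℕ i) ≡ v i
  fromVector-toℕ v zero    = ≡.refl
  fromVector-toℕ v (suc i) = fromVector-toℕ (v ∘ suc) i

  fromVector-below : ∀ {n} (v : Vector n) → Below n (fromVector v)
  fromVector-below {zero}  v l       _         = refl
  fromVector-below {suc n} v (suc l) (s≤s n≤l) = fromVector-below (v ∘ suc) l n≤l

  module _ (r : Carrier) (k : ℕ) where

    open Quotient r k

    private
      n : ℕ
      n = suc k

    binom-wrap : ∀ l → l ≤ k → (binom n r 0 + r * binom n r n ◂ binom n r ∘ suc) l ≈ 0#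
    binom-wrap zero    _    = begin
      binom n r 0 + r * binom n r n   ≈⟨ +-cong (binom-bottom k r) (*-congˡ (binom-top n r)) ⟩
      - r + r * 1#                    ≈⟨ +-congˡ (*-identityʳ r) ⟩
      - r + r                         ≈⟨ -‿inverseˡ r ⟩
      0#                              ∎
    binom-wrap (suc l) sl≤k = binom-other n r (suc l) (ℕₚ.<⇒≢ (s≤s sl≤k)) (λ ())

    -- The coefficient of the product at d + e is `f d * g e`, which is nonzero over a field,
    -- whereas a multiple of x^n - r can be nonzero only at 0 and n; `1 ≤ d` excludes 0. The factor
    -- `c` stems from clearing denominators.
    degrees-add : ∀ {f g d e c} → 1 ≤ d → HasDegree f d → HasDegree g e →
                  (∀ i → (f · g) i ≈ c * binom n r i) → d ℕ.+ e ≡ n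
    degrees-add {f} {g} {d} {e} {c} 1≤d (f-lead , f-below) (g-lead , g-below) fg≈ with d ℕ.+ e ℕ.≟ n
    ... | yes d+e≡n = d+e≡n
    ... | no  d+e≢n = contradiction (unit-cancel (proj₂ (≉0⇒unit f-lead)) (begin
      f d * g e                     ≈⟨ conv-top d e f g f-below g-below ⟨
      (f · g) (d ℕ.+ e)             ≈⟨ fg≈ (d ℕ.+ e) ⟩
      c * binom n r (d ℕ.+ e)       ≈⟨ *-congˡ (binom-other n r _ d+e≢n (ℕₚ.m<n⇒n≢0 (ℕₚ.≤-trans 1≤d (ℕₚ.m≤m+n d e)))) ⟩
      c * 0#                        ≈⟨ zeroʳ c ⟩
      0#                            ∎)) g-lead

    -- The reversed coefficients of f form a left kernel vector of circ g, because f(u) g(u) = c (u ^ n - r) = 0.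
    factor⇒Det≈0 : ∀ {f g d e c} → 1 ≤ d → 1 ≤ e → HasDegree f d → HasDegree g e →
                   (∀ i → (f · g) i ≈ c * binom n r i) → Det n (circ g) ≈ 0#
    factor⇒Det≈0 {f} {g} {d} {e} {c} 1≤d 1≤e f-deg@(f-lead , f-below) g-deg@(g-lead , g-below) fg≈ =
      kernel⇒Det≈0 n (circ g) (reversed f) kernel top (f-lead ∘ trans (reflexive (≡.cong f (≡.sym k∸top≡d))))
      where
      d+e≡n : d ℕ.+ e ≡ n
      d+e≡n = degrees-add 1≤d f-deg g-deg fg≈
      d≤k : d ≤ k
      d≤k = ℕₚ.≤-pred (≡.subst (d <_) d+e≡n (ℕₚ.m<m+n d 1≤e))
      top<n : k ∸ d < n
      top<n = s≤s (ℕₚ.m∸n≤m k d)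
      -- The position at which `reversed f` holds the leading coefficient of `f`, which makes the
      -- kernel vector nonzero. It exists because `1 ≤ e` forces `d ≤ k`.
      top : Fin n
      top = fromℕ< top<n
      k∸top≡d : k ∸ toℕ top ≡ d
      k∸top≡d = ≡.trans (≡.cong (k ∸_) (toℕ-fromℕ< top<n)) (ℕₚ.m∸[m∸n]≡n d≤k)
      fg : ℕ → Carrier
      fg i = c * binom n r i
      fg-wrap : ∀ l → l ≤ k → (fg 0 + r * fg n ◂ fg ∘ suc) l ≈ 0#
      fg-wrap zero l≤k = begin
        c * binom n r 0 + r * (c * binom n r n)   ≈⟨ solve 4 (λ c a r b → c :* a :+ r :* (c :* b) := c :* (a :+ r :* b)) refl c (binom n r 0) r (binom n r n) ⟩
        c * (binom n r 0 + r * binom n r n)       ≈⟨ trans (*-congˡ (binom-wrap 0 l≤k)) (zeroʳ c) ⟩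
        0#                                        ∎
      fg-wrap (suc l) l≤k = trans (*-congˡ (binom-wrap (suc l) l≤k)) (zeroʳ c)
      kernel : ∀ j → (reversed f ᵀ* circ g) j ≈ 0#
      kernel j = begin
        (reversed f ᵀ* circ g) j          ≈⟨ circ-H f g j ⟩
        H n f g l                         ≈⟨ H-pad f g (s≤s d≤k) f-below l ⟩
        H (suc d) f g l                   ≈⟨ H-reduce d e f g 1≤d d+e≡n f-below g-below fg fg≈ l ⟩
        (fg 0 + r * fg n ◂ fg ∘ suc) l    ≈⟨ fg-wrap l (ℕₚ.m∸n≤m k (toℕ j)) ⟩
        0#                                ∎
        where
        l : ℕ
        l = k ∸ toℕ j

    module Division {x} (d′ e : ℕ) (e+d≡n : e ℕ.+ suc d′ ≡ n) (1≤e : 1 ≤ e)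
      (y : ℕ → Carrier) {b} (byd≈1 : b * y (suc d′) ≈ 1#) (y-below : Below (suc (suc d′)) y) (y∈I : Ideal x y) where

      private
        d : ℕ
        d = suc d′
        P : ℕ → Carrier
        P = binom n r

      d<n : d < n
      d<n = ≡.subst (d <_) e+d≡n (ℕₚ.+-monoˡ-≤ d 1≤e)

      P-below : Below (suc e ℕ.+ d) P
      P-below i e+d<i = binom-other n r i (ℕₚ.<⇒≢ n<i ∘ ≡.sym) (ℕₚ.m<n⇒n≢0 n<i)
        where
        n<i : n < i
        n<i = ≡.subst (_< i) e+d≡n e+d<i

      division : ∃ λ q → Below (suc e) q × Below d (λ i → P i - (q · y) i)
      division = divide d′ y byd≈1 y-below (suc e) P P-below

      q : ℕ → Carrier
      q = proj₁ division

      q-below : Below (suc e) q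
      q-below = proj₁ (proj₂ division)

      rem : ℕ → Carrier
      rem i = P i - (q · y) i

      rem-below : Below d rem
      rem-below = proj₂ (proj₂ division)

      wrap : ∀ l → l ≤ k → ((q · y) 0 + r * (q · y) n ◂ (q · y) ∘ suc) l ≈ - rem l
      wrap zero l≤k = begin
        (q · y) 0 + r * (q · y) n           ≈⟨ +-congˡ (*-congˡ qyn≈Pn) ⟩
        (q · y) 0 + r * P n                 ≈⟨ solve 3 (λ p q s → q :+ s := p :+ s :- (p :- q)) refl (P 0) ((q · y) 0) (r * P n) ⟩
        P 0 + r * P n - rem 0               ≈⟨ trans (+-congʳ (binom-wrap 0 l≤k)) (+-identityˡ _) ⟩
        - rem 0                             ∎
        where
        qyn≈Pn : (q · y) n ≈ P n
        qyn≈Pn = sym (x∙y⁻¹≈ε⇒x≈y (P n) ((q · y) n) (rem-below n (ℕₚ.<⇒≤ d<n)))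
      wrap (suc l) l≤k = begin
        (q · y) (suc l)                     ≈⟨ +-identityˡ _ ⟨
        0# + (q · y) (suc l)                ≈⟨ +-congʳ (trans (-‿cong (binom-wrap (suc l) l≤k)) -0#≈0#) ⟨
        - P (suc l) + (q · y) (suc l)       ≈⟨ solve 2 (λ p q → :- p :+ q := :- (p :- q)) refl (P (suc l)) ((q · y) (suc l)) ⟩
        - rem (suc l)                       ∎

      -- In the quotient x^n - r is 0, so `rem` represents -(q y), a multiple of `y`.
      rem∈I : Ideal x rem
      rem∈I = Ideal-resp rem≈ (Ideal-scale (- 1#) (Ideal-H (suc e) q y∈I))
        where
        rem≈ : (λ l → - 1# * H (suc e) q y l) ≈ᵏ rem
        rem≈ l l≤k = begin
          - 1# * H (suc e) q y l            ≈⟨ *-congˡ (trans (H-reduce e d q y 1≤e e+d≡n q-below y-below (q · y) (λ _ → refl) l) (wrap l l≤k)) ⟩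
          - 1# * - rem l                    ≈⟨ solve 2 (λ a b → :- a :* :- b := a :* b) refl 1# (rem l) ⟩
          1# * rem l                        ≈⟨ *-identityˡ _ ⟩
          rem l                             ∎

      -- Without a remainder x^n - r is q y. Both degrees are positive, and `q` has exact degree `e`
      -- because `q e * y d` is the leading coefficient 1.
      reducible : (∀ i → rem i ≈ 0#) → BinomReducible n r
      reducible rem≈0 = q , y , e , d , 1≤e , s≤s z≤n , (q-lead , q-below) , (unit⇒≉0 byd≈1 , y-below) , qy≈P
        where
        qy≈P : ∀ i → (q · y) i ≈ P i
        qy≈P i = sym (x∙y⁻¹≈ε⇒x≈y (P i) ((q · y) i) (rem≈0 i))
        q-lead : ¬ q e ≈ 0#
        q-lead qe≈0 = 1≉0 (begin
          1#                  ≈⟨ binom-top n r ⟨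
          P n                 ≈⟨ qy≈P n ⟨
          (q · y) n           ≡⟨ ≡.cong (q · y) e+d≡n ⟨
          (q · y) (e ℕ.+ d)   ≈⟨ conv-top e d q y q-below y-below ⟩
          q e * y d           ≈⟨ trans (*-congʳ qe≈0) (zeroˡ _) ⟩
          0#                  ∎)

    -- Euclid's algorithm: x ^ n - r is divided by an ideal element y, the remainder being an ideal element of smaller degree.
    zero⊎one∈Ideal : BinomIrreducible n r → ∀ {x} N → N ≤ n → ∀ y → Ideal x y → Below N y →
                     (∀ i → y i ≈ 0#) ⊎ Ideal x one
    zero⊎one∈Ideal irred {x} zero    _   y y∈I y-below = inj₁ λ i → y-below i z≤n
    zero⊎one∈Ideal irred {x} (suc d) d<n y y∈I y-below = [ vanishing , leading d d<n y-below ]′ (inverse (y d))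
      where
      Goal : Set
      Goal = (∀ i → y i ≈ 0#) ⊎ Ideal x one
      vanishing : y d ≈ 0# → Goal
      vanishing yd≈0 = zero⊎one∈Ideal irred d (ℕₚ.<⇒≤ d<n) y y∈I below
        where
        below : Below d y
        below i d≤i = [ y-below i , (λ { ≡.refl → yd≈0 }) ]′ (ℕₚ.m≤n⇒m<n∨m≡n d≤i)
      leading : ∀ d → suc d ≤ n → Below (suc d) y → (∃ λ b → b * y d ≈ 1#) → Goal
      leading zero     _   y-below (b , by₀≈1) = inj₂ (Ideal-resp by≈one (Ideal-scale b y∈I))
        where
        by≈one : (λ l → b * y l) ≈ᵏ one
        by≈one zero    _ = by₀≈1
        by≈one (suc l) _ = trans (*-congˡ (y-below (suc l) (s≤s z≤n))) (zeroʳ b)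
      -- The dividend is x^n - r at every stage, not the previous remainder, so a single decreasing
      -- degree bound drives the recursion, and a remainder of zero at any stage contradicts
      -- irreducibility at once.
      leading d@(suc d′) d<n y-below (b , byd≈1) = [ (λ rem≈0 → contradiction (reducible rem≈0) irred) , inj₂ ]′
        (zero⊎one∈Ideal irred d (ℕₚ.<⇒≤ d<n) rem rem∈I rem-below)
        where
        open Division d′ (n ∸ d) (ℕₚ.m∸n+n≡m {n} {d} (ℕₚ.<⇒≤ d<n)) (ℕₚ.m<n⇒0<n∸m {d} {n} d<n) y byd≈1 y-below y∈I using (rem; rem∈I; rem-below; reducible)

    irreducible⇒Det≉0 : BinomIrreducible n r → ∀ x → Below n x → ¬ (∀ i → x i ≈ 0#) → ¬ Det n (circ x) ≈ 0#
    irreducible⇒Det≉0 irred x x-below x≉0 with zero⊎one∈Ideal irred n ℕₚ.≤-refl x x∈I x-below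
      where
      x∈I : Ideal x x
      x∈I = one , λ l _ → trans (H-pad {1} {n} one x (s≤s z≤n) (λ { (suc i) _ → refl }) l) (one-x l)
        where
        one-x : ∀ l → H 1 one x l ≈ x l
        one-x zero    = trans (+-cong (*-identityˡ _) (zeroʳ r)) (+-identityʳ _)
        one-x (suc l) = trans (+-identityʳ _) (*-identityˡ _)
    ... | inj₁ x≈0   = contradiction x≈0 x≉0
    ... | inj₂ one∈I = surjective⇒Det≉0 n (circ x) surjective
      where
      surjective : (w : Vector n) → ∃ λ (v : Vector n) → ∀ j → (v ᵀ* circ x) j ≈ w j
      -- `circ-H` delivers the product backwards, so the target is reversed before it is written as
      -- a multiple of 1.
      surjective w with Ideal-H n (fromVector (w ∘ opposite)) one∈I
      ... | g , gx≈ = reversed g , λ j → begin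
        (reversed g ᵀ* circ x) j                          ≈⟨ circ-H g x j ⟩
        H n g x (k ∸ toℕ j)                               ≈⟨ gx≈ (k ∸ toℕ j) (ℕₚ.m∸n≤m k (toℕ j)) ⟩
        H n (fromVector (w ∘ opposite)) one (k ∸ toℕ j)   ≈⟨ H-one n _ (k ∸ toℕ j) ℕₚ.≤-refl (fromVector-below (w ∘ opposite)) ⟩
        fromVector (w ∘ opposite) (k ∸ toℕ j)             ≡⟨ ≡.cong (fromVector (w ∘ opposite)) (opposite-prop j) ⟨
        fromVector (w ∘ opposite) (toℕ (opposite j))      ≡⟨ fromVector-toℕ (w ∘ opposite) (opposite j) ⟩
        w (opposite (opposite j))                         ≡⟨ ≡.cong w (opposite-involutive j) ⟩
        w j                                               ∎

    module Root (a : Carrier) (aⁿ≈r : a ^ n ≈ r) where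

      eval : ℕ → (ℕ → Carrier) → Carrier
      eval zero    y = 0#
      eval (suc L) y = y 0 + a * eval L (y ∘ suc)

      eval-snoc : ∀ L y → eval (suc L) y ≈ eval L y + a ^ L * y L
      eval-snoc zero    y = trans (+-cong (sym (*-identityˡ _)) (zeroʳ a)) (+-comm _ _)
      eval-snoc (suc L) y = begin
        y 0 + a * eval (suc L) (y ∘ suc)                            ≈⟨ +-congˡ (*-congˡ (eval-snoc L (y ∘ suc))) ⟩
        y 0 + a * (eval L (y ∘ suc) + a ^ L * y (suc L))            ≈⟨ solve 5 (λ y a s p t → y :+ a :* (s :+ p :* t) := y :+ a :* s :+ a :* p :* t) refl (y 0) a _ (a ^ L) (y (suc L)) ⟩
        y 0 + a * eval L (y ∘ suc) + a ^ suc L * y (suc L)          ∎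

      eval-sum : ∀ L y → eval L y ≈ sum {L} (λ i → a ^ toℕ i * y (toℕ i))
      eval-sum zero    y = refl
      eval-sum (suc L) y = +-cong (sym (*-identityˡ _)) (begin
        a * eval L (y ∘ suc)         ≈⟨ *-congˡ (eval-sum L (y ∘ suc)) ⟩
        a * sum term                 ≈⟨ *-distribˡ-sum a term ⟩
        sum (λ i → a * term i)       ≈⟨ sum-cong-≋ {L} (λ i → sym (*-assoc a (a ^ toℕ i) (y (suc (toℕ i))))) ⟩
        sum {L} (λ i → a ^ suc (toℕ i) * y (suc (toℕ i))) ∎)
        where
        term : Vector L
        term i = a ^ toℕ i * y (suc (toℕ i))

      -- Substituting `a` for u respects the relation u ^ n = r, because `a ^ n ≈ r`: the wrapped
      -- coefficient `r * y k` is what a ^ n contributes.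
      eval-U : ∀ y → eval n (U y) ≈ a * eval n y
      eval-U y = begin
        r * y k + a * eval k y            ≈⟨ +-comm _ _ ⟩
        a * eval k y + r * y k            ≈⟨ +-congˡ (*-congʳ aⁿ≈r) ⟨
        a * eval k y + a * a ^ k * y k    ≈⟨ solve 4 (λ a s p t → a :* s :+ a :* p :* t := a :* (s :+ p :* t)) refl a (eval k y) (a ^ k) (y k) ⟩
        a * (eval k y + a ^ k * y k)      ≈⟨ *-congˡ (eval-snoc k y) ⟨
        a * eval n y                      ∎

      eval-U^ : ∀ j y → eval n y ≈ 0# → eval n (U^ j y) ≈ 0#
      eval-U^ zero    y y≈0 = y≈0
      eval-U^ (suc j) y y≈0 = trans (eval-U (U^ j y)) (trans (*-congˡ (eval-U^ j y y≈0)) (zeroʳ a))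

      -- The kernel vector of powers of `a` is nonzero at index 0, where it equals 1, so the case
      -- that `a` itself is 0 is covered.
      root⇒Det≈0 : ∀ y → eval n y ≈ 0# → Det n (circ y) ≈ 0#
      root⇒Det≈0 y y≈0 = kernel⇒Det≈0 n (circ y) (λ i → a ^ toℕ i)
        (λ j → trans (sym (eval-sum n (U^ (toℕ j) y))) (eval-U^ (toℕ j) y y≈0)) zero 1≉0

  ι-D : ∀ r k x → ι (D r (suc k) x) ≈ Det (suc k) (Quotient.circ (ι r) k (ι ∘ at x))
  ι-D r k x = trans (ι-det (suc k) (Mat r (suc k) x)) (Det-cong (suc k) entry)
    where
    open Quotient (ι r) k
    entry : ∀ i j → ι (Mat r (suc k) x i j) ≈ circ (ι ∘ at x) i j
    entry i j with toℕ j ℕ.≤? toℕ i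
    ... | yes j≤i = sym (U^-shift (toℕ j) (ι ∘ at x) (toℕ i) j≤i)
    ... | no  j≰i = trans (ι-* r _) (sym (U^-wrap (toℕ j) (ι ∘ at x) (toℕ i) (ℕₚ.≰⇒> j≰i) (ℕₚ.<⇒≤ (toℕ<n j))))

  ι-at-toℕ : ∀ {n} (x : Fin n → ℤ) i → ι (at x (toℕ i)) ≈ ι (x i)
  ι-at-toℕ x i = reflexive (≡.cong ι (at-toℕ x i))

  ι-at-below : ∀ {n} (x : Fin n → ℤ) → Below n (ι ∘ at x)
  ι-at-below x l n≤l = trans (reflexive (≡.cong ι (at-≥ x l n≤l))) ι-0

  irreducible⇒D≉0 : ∀ {k r r₀} → ι r ≈ r₀ → BinomIrreducible (suc k) r₀ →
                    ∀ x → (∃ λ i → ¬ ι (x i) ≈ 0#) → ¬ ι (D r (suc k) x) ≈ 0#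
  irreducible⇒D≉0 {k} {r} r≈r₀ irred x (i , xᵢ≉0) D≈0 =
    irreducible⇒Det≉0 (ι r) k
      (λ { (f , g , d , e , 1≤d , 1≤e , f-deg , g-deg , fg≈) →
           irred (f , g , d , e , 1≤d , 1≤e , f-deg , g-deg , λ j → trans (fg≈ j) (binom-cong (suc k) r≈r₀ j)) })
      (ι ∘ at x) (ι-at-below x) (λ x≈0 → xᵢ≉0 (trans (sym (ι-at-toℕ x i)) (x≈0 (toℕ i))))
      (trans (sym (ι-D r k x)) D≈0)

  -- The second hypothesis clears denominators.
  reducible⇒D≈0 : ∀ {k r r₀} → ι r ≈ r₀ →
    (∀ {n} (v : Vector n) → ∃ λ c → (¬ c ≈ 0#) × ∃ λ (x : Fin n → ℤ) → ∀ i → ι (x i) ≈ c * v i) →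
    BinomReducible (suc k) r₀ → ∃ λ x → (∃ λ i → ¬ ι (x i) ≈ 0#) × ι (D r (suc k) x) ≈ 0#
  reducible⇒D≈0 {k} {r} {r₀} r≈r₀ clear (f , g , d , e , 1≤d , 1≤e , f-deg , g-deg@(g-lead , g-below) , fg≈)
    with clear {suc k} (g ∘ toℕ)
  ... | c , c≉0 , x , x≈cg = x , (top , x-top≉0) , trans (ι-D r k x)
      (factor⇒Det≈0 (ι r) k 1≤d 1≤e f-deg (h-lead , h-below) λ i → trans (conv-scaleʳ c f g h h≈cg i) (*-congˡ (fg≈binom i)))
    where
    fg≈binom : ∀ i → (f · g) i ≈ binom (suc k) (ι r) i
    fg≈binom i = trans (fg≈ i) (sym (binom-cong (suc k) r≈r₀ i))
    -- As `1 ≤ d`, the degree of `g` is below n, so the n entries handed to `clear` contain all its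
    -- nonzero coefficients.
    e<n : e < suc k
    e<n = ≡.subst (e <_) (degrees-add (ι r) k 1≤d f-deg g-deg (λ i → trans (fg≈binom i) (sym (*-identityˡ _))))
            (ℕₚ.+-monoˡ-≤ e 1≤d)
    top : Fin (suc k)
    top = fromℕ< e<n
    h : ℕ → Carrier
    h = ι ∘ at x
    h≈cg : ∀ i → h i ≈ c * g i
    h≈cg i with i ℕ.<? suc k
    ... | yes i<n = trans (x≈cg (fromℕ< i<n)) (reflexive (≡.cong (λ t → c * g t) (toℕ-fromℕ< i<n)))
    ... | no  i≮n = trans ι-0 (sym (trans (*-congˡ (g-below i (ℕₚ.≤-trans e<n (ℕₚ.≮⇒≥ i≮n)))) (zeroʳ c)))
    h-lead : ¬ h e ≈ 0#
    h-lead he≈0 = g-lead (unit-cancel (proj₂ (≉0⇒unit c≉0)) (trans (sym (h≈cg e)) he≈0))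
    h-below : ∀ i → e < i → h i ≈ 0#
    h-below i e<i = trans (h≈cg i) (trans (*-congˡ (g-below i e<i)) (zeroʳ c))
    x-top≉0 : ¬ ι (x top) ≈ 0#
    x-top≉0 x≈0 = h-lead (trans (reflexive (≡.cong h (≡.sym (toℕ-fromℕ< e<n)))) (trans (ι-at-toℕ x top) x≈0))

  root⇒D≈0 : ∀ {k r a} → a ^ suc k ≈ ι r → ∀ x → sum {suc k} (λ i → a ^ toℕ i * ι (x i)) ≈ 0# → ι (D r (suc k) x) ≈ 0#
  root⇒D≈0 {k} {r} {a} aⁿ≈r x sum≈0 = trans (ι-D r k x) (root⇒Det≈0 (ι ∘ at x) (begin
    eval (suc k) (ι ∘ at x)                                   ≈⟨ eval-sum (suc k) (ι ∘ at x) ⟩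
    sum {suc k} (λ i → a ^ toℕ i * ι (at x (toℕ i)))          ≈⟨ sum-cong-≋ {suc k} term ⟩
    sum {suc k} (λ i → a ^ toℕ i * ι (x i))                   ≈⟨ sum≈0 ⟩
    0#                                                        ∎))
    where
    open Root (ι r) k a aⁿ≈r
    term : ∀ i → a ^ toℕ i * ι (at x (toℕ i)) ≈ a ^ toℕ i * ι (x i)
    term i = *-congˡ (ι-at-toℕ x i)

  collision⇒D≈0 : ∀ {k r a} → a ^ suc k ≈ ι r → ∀ (u v : Fin (suc k) → ℤ) →
    sum (λ i → a ^ toℕ i * ι (u i)) ≈ sum (λ i → a ^ toℕ i * ι (v i)) → ι (D r (suc k) (λ i → u i ℤ.- v i)) ≈ 0#
  collision⇒D≈0 {k} {r} {a} aⁿ≈r u v su≈sv = root⇒D≈0 aⁿ≈r (λ i → u i ℤ.- v i) (begin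
    sum (λ i → a ^ toℕ i * ι (u i ℤ.- v i))           ≈⟨ sum-cong-≋ difference ⟩
    sum (λ i → au i - av i)                           ≈⟨ ∑-distrib-+ au (λ i → - av i) ⟩
    sum au + sum (λ i → - av i)                       ≈⟨ +-cong su≈sv (sum-neg av) ⟩
    sum av - sum av                                   ≈⟨ -‿inverseʳ _ ⟩
    0#                                                ∎)
    where
    au av : Vector (suc k)
    au i = a ^ toℕ i * ι (u i)
    av i = a ^ toℕ i * ι (v i)
    difference : ∀ i → a ^ toℕ i * ι (u i ℤ.- v i) ≈ au i - av i
    difference i = trans (*-congˡ (trans (ι-+ (u i) (ℤ.- v i)) (+-congˡ (ι-neg (v i)))))
      (solve 3 (λ a u v → a :* (u :- v) := a :* u :- a :* v) refl (a ^ toℕ i) (ι (u i)) (ι (v i)))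

-- The field of residues mod p

module ResidueField (p : ℕ) (p-prime : Prime p) where

  infix 4 _≈_
  _≈_ : ℤ → ℤ → Set
  a ≈ b = + p ∣ (a ℤ.- b)

  multiple⇒≈ : ∀ a b q → a ℤ.- b ≡ q ℤ.* + p → a ≈ b
  multiple⇒≈ a b q eq = Signed.∣⇒∣ᵤ (Signed.divides q eq)

  ≈⇒multiple : ∀ a b → a ≈ b → ∃ λ q → a ℤ.- b ≡ q ℤ.* + p
  ≈⇒multiple a b a≈b with Signed.∣ᵤ⇒∣ {+ p} {a ℤ.- b} a≈b
  ... | Signed.divides q eq = q , eq

  ≡⇒≈ : ∀ {a b} → a ≡ b → a ≈ b
  ≡⇒≈ {a} ≡.refl = multiple⇒≈ a a (+ 0) (≡.trans (ℤₚ.+-inverseʳ a) (≡.sym (ℤₚ.*-zeroˡ (+ p))))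

  ≈-sym : ∀ {a b} → a ≈ b → b ≈ a
  ≈-sym {a} {b} a≈b with ≈⇒multiple a b a≈b
  ... | q , eq = multiple⇒≈ b a (ℤ.- q) (≡.trans (flip a b) (≡.trans (≡.cong ℤ.-_ eq) (ℤₚ.neg-distribˡ-* q (+ p))))
    where
    flip : ∀ a b → b ℤ.- a ≡ ℤ.- (a ℤ.- b)
    flip = solve-∀

  ≈-trans : ∀ {a b c} → a ≈ b → b ≈ c → a ≈ c
  ≈-trans {a} {b} {c} a≈b b≈c with ≈⇒multiple a b a≈b | ≈⇒multiple b c b≈c
  ... | q , eq | q′ , eq′ = multiple⇒≈ a c (q ℤ.+ q′)
    (≡.trans (split a b c) (≡.trans (≡.cong₂ ℤ._+_ eq eq′) (≡.sym (ℤₚ.*-distribʳ-+ (+ p) q q′))))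
    where
    split : ∀ a b c → a ℤ.- c ≡ a ℤ.- b ℤ.+ (b ℤ.- c)
    split = solve-∀

  +-cong : ∀ {a b c d} → a ≈ b → c ≈ d → a ℤ.+ c ≈ b ℤ.+ d
  +-cong {a} {b} {c} {d} a≈b c≈d with ≈⇒multiple a b a≈b | ≈⇒multiple c d c≈d
  ... | q , eq | q′ , eq′ = multiple⇒≈ (a ℤ.+ c) (b ℤ.+ d) (q ℤ.+ q′)
    (≡.trans (split a b c d) (≡.trans (≡.cong₂ ℤ._+_ eq eq′) (≡.sym (ℤₚ.*-distribʳ-+ (+ p) q q′))))
    where
    split : ∀ a b c d → a ℤ.+ c ℤ.- (b ℤ.+ d) ≡ a ℤ.- b ℤ.+ (c ℤ.- d)
    split = solve-∀

  *-cong : ∀ {a b c d} → a ≈ b → c ≈ d → a ℤ.* c ≈ b ℤ.* d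
  *-cong {a} {b} {c} {d} a≈b c≈d with ≈⇒multiple a b a≈b | ≈⇒multiple c d c≈d
  ... | q , eq | q′ , eq′ = multiple⇒≈ (a ℤ.* c) (b ℤ.* d) (q ℤ.* c ℤ.+ b ℤ.* q′)
    (≡.trans (split a b c d) (≡.trans (≡.cong₂ (λ s t → s ℤ.* c ℤ.+ b ℤ.* t) eq eq′) (collect q c b q′ (+ p))))
    where
    split : ∀ a b c d → a ℤ.* c ℤ.- b ℤ.* d ≡ (a ℤ.- b) ℤ.* c ℤ.+ b ℤ.* (c ℤ.- d)
    split = solve-∀
    collect : ∀ q c b q′ n → q ℤ.* n ℤ.* c ℤ.+ b ℤ.* (q′ ℤ.* n) ≡ (q ℤ.* c ℤ.+ b ℤ.* q′) ℤ.* n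
    collect = solve-∀

  neg-cong : ∀ {a b} → a ≈ b → ℤ.- a ≈ ℤ.- b
  neg-cong {a} {b} a≈b with ≈⇒multiple a b a≈b
  ... | q , eq = multiple⇒≈ (ℤ.- a) (ℤ.- b) (ℤ.- q) (≡.trans (distrib a b) (≡.trans (≡.cong ℤ.-_ eq) (ℤₚ.neg-distribˡ-* q (+ p))))
    where
    distrib : ∀ a b → ℤ.- a ℤ.- ℤ.- b ≡ ℤ.- (a ℤ.- b)
    distrib = solve-∀

  -- Integers under congruence, so that the underlying raw ring is `𝔽 p` by computation and the
  -- identity serves as `ι`.
  residueRing : CommutativeRing 0ℓ 0ℓ
  residueRing = record
    { Carrier = ℤ
    ; _≈_ = _≈_
    ; _+_ = ℤ._+_
    ; _*_ = ℤ._*_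
    ; -_ = ℤ.-_
    ; 0# = + 0
    ; 1# = + 1
    ; isCommutativeRing = record
      { isRing = record
        { +-isAbelianGroup = record
          { isGroup = record
            { isMonoid = record
              { isSemigroup = record
                { isMagma = record
                  { isEquivalence = record
                    { refl  = λ {a} → ≡⇒≈ {a} ≡.refl
                    ; sym   = λ {a} {b} → ≈-sym {a} {b}
                    ; trans = λ {a} {b} {c} → ≈-trans {a} {b} {c}
                    }
                  ; ∙-cong = λ {a} {b} {c} {d} → +-cong {a} {b} {c} {d}
                  }
                ; assoc = λ a b c → ≡⇒≈ (ℤₚ.+-assoc a b c)
                }
              ; identity = (λ a → ≡⇒≈ (ℤₚ.+-identityˡ a)) , (λ a → ≡⇒≈ (ℤₚ.+-identityʳ a))
              }
            ; inverse = (λ a → ≡⇒≈ (ℤₚ.+-inverseˡ a)) , (λ a → ≡⇒≈ (ℤₚ.+-inverseʳ a))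
            ; ⁻¹-cong = λ {a} {b} → neg-cong {a} {b}
            }
          ; comm = λ a b → ≡⇒≈ (ℤₚ.+-comm a b)
          }
        ; *-cong = λ {a} {b} {c} {d} → *-cong {a} {b} {c} {d}
        ; *-assoc = λ a b c → ≡⇒≈ (ℤₚ.*-assoc a b c)
        ; *-identity = (λ a → ≡⇒≈ (ℤₚ.*-identityˡ a)) , (λ a → ≡⇒≈ (ℤₚ.*-identityʳ a))
        ; distrib = (λ a b c → ≡⇒≈ (ℤₚ.*-distribˡ-+ a b c)) , (λ a b c → ≡⇒≈ (ℤₚ.*-distribʳ-+ a b c))
        }
      ; *-comm = λ a b → ≡⇒≈ (ℤₚ.*-comm a b)
      }
    }

  reduction : IsRingHomomorphism ℤ.+-*-rawRing (CommutativeRing.rawRing residueRing) id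
  reduction = record
    { isSemiringHomomorphism = record
      { isNearSemiringHomomorphism = record
        { +-isMonoidHomomorphism = record
          { isMagmaHomomorphism = record
            { isRelHomomorphism = record { cong = ≡⇒≈ }
            ; homo = λ a b → ≡⇒≈ {a ℤ.+ b} ≡.refl
            }
          ; ε-homo = ≡⇒≈ {+ 0} ≡.refl
          }
        ; *-homo = λ a b → ≡⇒≈ {a ℤ.* b} ≡.refl
        }
      ; 1#-homo = ≡⇒≈ {+ 1} ≡.refl
      }
    ; -‿homo = λ a → ≡⇒≈ {ℤ.- a} ≡.refl
    }

  ∣⇒≈0 : ∀ a → + p ∣ a → a ≈ + 0
  ∣⇒≈0 a = ≡.subst (+ p ∣_) (≡.sym (ℤₚ.+-identityʳ a))

  ≈0⇒∣ : ∀ a → a ≈ + 0 → + p ∣ a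
  ≈0⇒∣ a = ≡.subst (+ p ∣_) (ℤₚ.+-identityʳ a)

  1≉0 : ¬ (+ 1 ≈ + 0)
  1≉0 p∣1 = ℕ.nonTrivial⇒≢1 ⦃ prime⇒nonTrivial p-prime ⦄ (ℕ∣.∣1⇒≡1 p∣1)

  -- Bézout's identity in ℕ comes in two forms: 1 + y n = x p gives the inverse -y, and 1 + x p = y
  -- n gives y.
  inverse-ℕ : ∀ n → ¬ p ℕ∣.∣ n → ∃ λ b → b ℤ.* + n ≈ + 1
  inverse-ℕ n p∤n with coprime-Bézout coprime
    where
    coprime : Coprime p n
    coprime (d∣p , d∣n) with prime⇒irreducible p-prime d∣p
    ... | inj₁ d≡1  = d≡1
    ... | inj₂ ≡.refl = contradiction d∣n p∤n
  ... | Bézout.+- x y eq = ℤ.- + y , multiple⇒≈ (ℤ.- + y ℤ.* + n) (+ 1) (ℤ.- + x) (begin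
    ℤ.- + y ℤ.* + n ℤ.- + 1         ≡⟨ regroup (+ y) (+ n) ⟩
    ℤ.- (+ 1 ℤ.+ + y ℤ.* + n)       ≡⟨ ≡.cong (λ t → ℤ.- (+ 1 ℤ.+ t)) (ℤₚ.pos-* y n) ⟨
    ℤ.- + (1 ℕ.+ y ℕ.* n)           ≡⟨ ≡.cong (λ t → ℤ.- + t) eq ⟩
    ℤ.- + (x ℕ.* p)                 ≡⟨ ≡.cong ℤ.-_ (ℤₚ.pos-* x p) ⟩
    ℤ.- (+ x ℤ.* + p)               ≡⟨ ℤₚ.neg-distribˡ-* (+ x) (+ p) ⟩
    ℤ.- + x ℤ.* + p                 ∎)
    where
    open ≡.≡-Reasoning
    regroup : ∀ y n → ℤ.- y ℤ.* n ℤ.- + 1 ≡ ℤ.- (+ 1 ℤ.+ y ℤ.* n)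
    regroup = solve-∀
  ... | Bézout.-+ x y eq = + y , multiple⇒≈ (+ y ℤ.* + n) (+ 1) (+ x) (begin
    + y ℤ.* + n ℤ.- + 1             ≡⟨ ≡.cong (ℤ._- + 1) (ℤₚ.pos-* y n) ⟨
    + (y ℕ.* n) ℤ.- + 1             ≡⟨ ≡.cong (λ t → + t ℤ.- + 1) eq ⟨
    + 1 ℤ.+ + (x ℕ.* p) ℤ.- + 1     ≡⟨ cancel (+ (x ℕ.* p)) ⟩
    + (x ℕ.* p)                     ≡⟨ ℤₚ.pos-* x p ⟩
    + x ℤ.* + p                     ∎)
    where
    open ≡.≡-Reasoning
    cancel : ∀ a → + 1 ℤ.+ a ℤ.- + 1 ≡ a
    cancel = solve-∀

  inverse : ∀ a → a ≈ + 0 ⊎ (∃ λ b → b ℤ.* a ≈ + 1)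
  inverse a with p ℕ∣.∣? ℤ.∣ a ∣
  ... | yes p∣a = inj₁ (∣⇒≈0 a p∣a)
  ... | no  p∤a with inverse-ℕ ℤ.∣ a ∣ p∤a | ℤₚ.+∣i∣≡i⊎+∣i∣≡-i a
  ...   | b , b∣a∣≈1 | inj₁ ∣a∣≡a  = inj₂ (b , ≡.subst (λ t → b ℤ.* t ≈ + 1) ∣a∣≡a b∣a∣≈1)
  ...   | b , b∣a∣≈1 | inj₂ ∣a∣≡-a = inj₂ (ℤ.- b , ≡.subst (_≈ + 1) (≡.trans (≡.cong (b ℤ.*_) ∣a∣≡-a) (swap-neg b a)) b∣a∣≈1)
    where
    swap-neg : ∀ b a → b ℤ.* ℤ.- a ≡ ℤ.- b ℤ.* a
    swap-neg = solve-∀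

  open Criteria residueRing id reduction inverse 1≉0 public

  trivial-denominators : ∀ {n} (v : Fin n → ℤ) → ∃ λ c → (¬ c ≈ + 0) × ∃ λ (x : Fin n → ℤ) → ∀ i → x i ≈ c ℤ.* v i
  trivial-denominators v = + 1 , 1≉0 , v , λ i → ≡⇒≈ (≡.sym (ℤₚ.*-identityˡ (v i)))

-- Small solutions by the pigeonhole principle

-- Raising `m` by one raises the root by at most one: if the old upper bound `suc s ^ n` is reached,
-- then `suc m ≤ suc s ^ n`, which is strictly less than the next power.
floor-root : ∀ n .{{_ : NonZero n}} m → ∃ λ s → s ℕ.^ n ≤ m × suc m ≤ suc s ℕ.^ n
floor-root n@(suc _) zero    = 0 , z≤n , ℕₚ.≤-reflexive (≡.sym (ℕₚ.^-zeroˡ n))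
floor-root n@(suc _) (suc m) with floor-root n m
... | s , sⁿ≤m , m<tⁿ with suc s ℕ.^ n ℕ.≤? suc m
...   | yes tⁿ≤m′ = suc s , tⁿ≤m′ , ℕₚ.≤-<-trans m<tⁿ (ℕₚ.^-monoˡ-< n (ℕₚ.n<1+n (suc s)))
...   | no  tⁿ≰m′ = s , ℕₚ.m≤n⇒m≤1+n sⁿ≤m , ℕₚ.≰⇒> tⁿ≰m′

-- Makes `p ≤ suc s ^ n` strict, as the pigeonhole principle demands; here `2 ≤ n` enters. The base
-- `t` divides `p`, so it is 1 or `p`, and either case makes `p` equal to 1.
prime≢power : ∀ {p} → Prime p → ∀ {n} → 2 ≤ n → ∀ t → p ≢ t ℕ.^ n
prime≢power {p} p-prime {suc (suc m)} (s≤s (s≤s _)) t p≡tⁿ with prime⇒irreducible p-prime (ℕ∣.divides (t ℕ.^ suc m) (≡.trans p≡tⁿ (ℕₚ.*-comm t _)))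
... | inj₁ ≡.refl = ℕ.nonTrivial⇒≢1 ⦃ prime⇒nonTrivial p-prime ⦄ (≡.trans p≡tⁿ (ℕₚ.^-zeroˡ (suc (suc m))))
... | inj₂ ≡.refl = ℕ.nonTrivial⇒≢1 ⦃ prime⇒nonTrivial p-prime ⦄ (ℕₚ.m*n≡1⇒m≡1 t (t ℕ.^ m) tᵐ⁺¹≡1)
  where
  tᵐ⁺¹≡1 : t ℕ.* t ℕ.^ m ≡ 1
  tᵐ⁺¹≡1 = ℕₚ.*-cancelˡ-≡ (t ℕ.* t ℕ.^ m) 1 t ⦃ prime⇒nonZero p-prime ⦄ (≡.trans (≡.sym p≡tⁿ) (≡.sym (ℕₚ.*-identityʳ t)))

funToFin-cong : ∀ {m n} {f g : Fin m → Fin n} → (∀ i → f i ≡ g i) → funToFin f ≡ funToFin g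
funToFin-cong {zero}  f≗g = ≡.refl
funToFin-cong {suc m} f≗g = ≡.cong₂ combine (f≗g zero) (funToFin-cong (f≗g ∘ suc))

∣-∣≤ : ∀ {s a b} → a ≤ s → b ≤ s → ℤ.∣ + a ℤ.- + b ∣ ≤ s
∣-∣≤ {s} {a} {b} a≤s b≤s = ℕₚ.≤-trans (ℕₚ.≤-reflexive (≡.cong ℤ.∣_∣ (ℤₚ.m-n≡m⊖n a b)))
  (ℕₚ.≤-trans (ℤₚ.∣m⊝n∣≤m⊔n a b) (ℕₚ.⊔-lub a≤s b≤s))

-- The base `t` digits of `i`: this enumerates the tuples with entries below `t` by `Fin (t ^ n)`,
-- the form that `pigeonhole` accepts.
digits : ∀ {t} n → Fin (t ℕ.^ n) → Fin n → ℤ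
digits n i j = + toℕ (finToFun {n = n} i j)

digits-injective : ∀ {t n} (i i′ : Fin (t ℕ.^ n)) → (∀ j → digits n i j ≡ digits n i′ j) → i ≡ i′
digits-injective {t} {n} i i′ eq = begin
  i                                     ≡⟨ funToFin-finToFin {n} {t} i ⟨
  funToFin (finToFun {t} {n} i)         ≡⟨ funToFin-cong (λ j → toℕ-injective (ℤₚ.+-injective (eq j))) ⟩
  funToFin (finToFun {t} {n} i′)        ≡⟨ funToFin-finToFin {n} {t} i′ ⟩
  i′                                    ∎
  where open ≡.≡-Reasoning

module SmallSolution (p : ℕ) (p-prime : Prime p) where

  open ResidueField p p-prime
  open CommutativeRing residueRing using (semiring)
  open SemiringSum semiring using (sum)
  open SemiringExp semiring using (_^_)

  private instance
    p≢0 : NonZero p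
    p≢0 = prime⇒nonZero p-prime

  residue : ℤ → Fin p
  residue z = fromℕ< (n%ℕd<d z p)

  residue-injective : ∀ z w → residue z ≡ residue w → z ≈ w
  residue-injective z w eq = multiple⇒≈ z w (z /ℕ p ℤ.- w /ℕ p) (begin
    z ℤ.- w
      ≡⟨ ≡.cong₂ ℤ._-_ (a≡a%ℕn+[a/ℕn]*n z p) (a≡a%ℕn+[a/ℕn]*n w p) ⟩
    + (z %ℕ p) ℤ.+ z /ℕ p ℤ.* + p ℤ.- (+ (w %ℕ p) ℤ.+ w /ℕ p ℤ.* + p)
      ≡⟨ ≡.cong (λ t → + t ℤ.+ z /ℕ p ℤ.* + p ℤ.- (+ (w %ℕ p) ℤ.+ w /ℕ p ℤ.* + p)) remainders ⟩
    + (w %ℕ p) ℤ.+ z /ℕ p ℤ.* + p ℤ.- (+ (w %ℕ p) ℤ.+ w /ℕ p ℤ.* + p)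
      ≡⟨ cancel (+ (w %ℕ p)) (z /ℕ p) (w /ℕ p) (+ p) ⟩
    (z /ℕ p ℤ.- w /ℕ p) ℤ.* + p ∎)
    where
    open ≡.≡-Reasoning
    remainders : z %ℕ p ≡ w %ℕ p
    remainders = ≡.trans (≡.sym (toℕ-fromℕ< (n%ℕd<d z p))) (≡.trans (≡.cong toℕ eq) (toℕ-fromℕ< (n%ℕd<d w p)))
    cancel : ∀ r x y n → r ℤ.+ x ℤ.* n ℤ.- (r ℤ.+ y ℤ.* n) ≡ (x ℤ.- y) ℤ.* n
    cancel = solve-∀

  ^≡^ : ∀ a n → a ^ n ≡ a ℤ.^ n
  ^≡^ a zero    = ≡.refl
  ^≡^ a (suc n) = ≡.cong (a ℤ.*_) (^≡^ a n)

  weighted : ∀ {n} → ℤ → (Fin n → ℤ) → ℤ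
  weighted a x = sum (λ j → a ^ toℕ j ℤ.* x j)

  smallSolution : ∀ k r a → 2 ≤ suc k → a ℤ.^ suc k ≈ r →
    Σ (Fin (suc k) → ℤ) λ x → (Σ (Fin (suc k)) λ i → x i ≢ + 0) × (D r (suc k) x ≈ + 0) × (∀ i → ℤ.∣ x i ∣ ℕ.^ suc k < p)
  -- Taking the root of p - 1 instead of p gives `s ^ n < p`, hence the strict bound on the
  -- differences, which are at most `s` in absolute value. Maximality of `s` still gives at least p
  -- tuples with entries at most `s`.
  smallSolution k r a 2≤n aⁿ≈r with floor-root (suc k) (ℕ.pred p)
  ... | s , sⁿ≤p-1 , p≤tⁿ with pigeonhole p<tⁿ (λ i → residue (weighted a (digits {suc s} (suc k) i)))
    where
    p<tⁿ : p < suc s ℕ.^ suc k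
    p<tⁿ = ℕₚ.≤∧≢⇒< (≡.subst (_≤ suc s ℕ.^ suc k) (ℕₚ.suc-pred p) p≤tⁿ) (prime≢power p-prime 2≤n (suc s))
  ... | i , i′ , i<i′ , same = x , nonzero , collision⇒D≈0 {k} {r} {a} (≡.subst (_≈ r) (≡.sym (^≡^ a (suc k))) aⁿ≈r) u v
          (residue-injective (weighted a u) (weighted a v) same) , small
    where
    u v x : Fin (suc k) → ℤ
    u = digits {suc s} (suc k) i
    v = digits {suc s} (suc k) i′
    x j = u j ℤ.- v j
    nonzero : Σ (Fin (suc k)) λ j → x j ≢ + 0
    -- Distinct indices have distinct digits, so some coordinate differs, and decidable equality in
    -- ℤ locates it.
    nonzero = ¬∀⟶∃¬ (suc k) (λ j → x j ≡ + 0) (λ j → x j ℤₚ.≟ + 0) λ x≡0 →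
      <⇒≢ i<i′ (digits-injective {suc s} {suc k} i i′ (λ j → ℤₚ.i-j≡0⇒i≡j (u j) (v j) (x≡0 j)))
    small : ∀ j → ℤ.∣ x j ∣ ℕ.^ suc k < p
    small j = ℕₚ.≤-<-trans (ℕₚ.^-monoˡ-≤ (suc k) (∣-∣≤ (ℕₚ.≤-pred (toℕ<n (finToFun {suc s} {suc k} i j))) (ℕₚ.≤-pred (toℕ<n (finToFun {suc s} {suc k} i′ j)))))
      (ℕₚ.≤-<-trans sⁿ≤p-1 (ℕₚ.≤-reflexive (ℕₚ.suc-pred p)))

-- The rational field and clearing denominators

module Rationals where

  fromℤ : ℤ → ℚ.ℚ
  fromℤ z = z ℚ./ 1

  private
    -- `z / 1` is normalised by a gcd and does not compute for a variable `z`; identities are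
    -- therefore checked on unnormalised fractions, by cross-multiplication.
    toℚᵘ-fromℤ : ∀ z → ℚ.toℚᵘ (fromℤ z) ℚᵘ.≃ ℚᵘ.mkℚᵘ z 0
    toℚᵘ-fromℤ z = ℚₚ.toℚᵘ-fromℚᵘ (ℚᵘ.mkℚᵘ z 0)

  fromℤ-+ : ∀ a b → fromℤ (a ℤ.+ b) ≡ fromℤ a ℚ.+ fromℤ b
  fromℤ-+ a b = ℚₚ.toℚᵘ-injective (begin
    ℚ.toℚᵘ (fromℤ (a ℤ.+ b))                       ≈⟨ toℚᵘ-fromℤ (a ℤ.+ b) ⟩
    ℚᵘ.mkℚᵘ (a ℤ.+ b) 0                            ≈⟨ ℚᵘ.*≡* (≡.cong (ℤ._* + 1) (≡.cong₂ ℤ._+_ (≡.sym (ℤₚ.*-identityʳ a)) (≡.sym (ℤₚ.*-identityʳ b)))) ⟩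
    ℚᵘ.mkℚᵘ a 0 ℚᵘ.+ ℚᵘ.mkℚᵘ b 0                   ≈⟨ ℚᵘₚ.+-cong (toℚᵘ-fromℤ a) (toℚᵘ-fromℤ b) ⟨
    ℚ.toℚᵘ (fromℤ a) ℚᵘ.+ ℚ.toℚᵘ (fromℤ b)         ≈⟨ ℚₚ.toℚᵘ-homo-+ (fromℤ a) (fromℤ b) ⟨
    ℚ.toℚᵘ (fromℤ a ℚ.+ fromℤ b)                   ∎)
    where open SetoidReasoning ℚᵘₚ.≃-setoid

  fromℤ-* : ∀ a b → fromℤ (a ℤ.* b) ≡ fromℤ a ℚ.* fromℤ b
  fromℤ-* a b = ℚₚ.toℚᵘ-injective (begin
    ℚ.toℚᵘ (fromℤ (a ℤ.* b))                       ≈⟨ toℚᵘ-fromℤ (a ℤ.* b) ⟩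
    ℚᵘ.mkℚᵘ a 0 ℚᵘ.* ℚᵘ.mkℚᵘ b 0                   ≈⟨ ℚᵘₚ.*-cong (toℚᵘ-fromℤ a) (toℚᵘ-fromℤ b) ⟨
    ℚ.toℚᵘ (fromℤ a) ℚᵘ.* ℚ.toℚᵘ (fromℤ b)         ≈⟨ ℚₚ.toℚᵘ-homo-* (fromℤ a) (fromℤ b) ⟨
    ℚ.toℚᵘ (fromℤ a ℚ.* fromℤ b)                   ∎)
    where open SetoidReasoning ℚᵘₚ.≃-setoid

  fromℤ-neg : ∀ a → fromℤ (ℤ.- a) ≡ ℚ.- fromℤ a
  fromℤ-neg a = ℚₚ.toℚᵘ-injective (begin
    ℚ.toℚᵘ (fromℤ (ℤ.- a))         ≈⟨ toℚᵘ-fromℤ (ℤ.- a) ⟩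
    ℚᵘ.- ℚᵘ.mkℚᵘ a 0               ≈⟨ ℚᵘₚ.-‿cong (toℚᵘ-fromℤ a) ⟨
    ℚᵘ.- ℚ.toℚᵘ (fromℤ a)          ≈⟨ ℚₚ.toℚᵘ-homo‿- (fromℤ a) ⟨
    ℚ.toℚᵘ (ℚ.- fromℤ a)           ∎)
    where open SetoidReasoning ℚᵘₚ.≃-setoid

  fromℤ-≡0 : ∀ z → fromℤ z ≡ ℚ.0ℚ → z ≡ + 0
  fromℤ-≡0 z eq with ℚₚ.fromℚᵘ-injective {ℚᵘ.mkℚᵘ z 0} {ℚᵘ.mkℚᵘ (+ 0) 0} eq
  ... | ℚᵘ.*≡* z*1≡0 = ≡.trans (≡.sym (ℤₚ.*-identityʳ z)) z*1≡0

  fromℤ-hom : IsRingHomomorphism ℤ.+-*-rawRing ℚ.+-*-rawRing fromℤ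
  fromℤ-hom = record
    { isSemiringHomomorphism = record
      { isNearSemiringHomomorphism = record
        { +-isMonoidHomomorphism = record
          { isMagmaHomomorphism = record
            { isRelHomomorphism = record { cong = ≡.cong fromℤ }
            ; homo = fromℤ-+
            }
          ; ε-homo = ≡.refl
          }
        ; *-homo = fromℤ-*
        }
      ; 1#-homo = ≡.refl
      }
    ; -‿homo = fromℤ-neg
    }

  inverse : ∀ q → q ≡ ℚ.0ℚ ⊎ (∃ λ b → b ℚ.* q ≡ ℚ.1ℚ)
  inverse q with q ℚ.≟ ℚ.0ℚ
  ... | yes q≡0 = inj₁ q≡0
  ... | no  q≢0 = inj₂ ((ℚ.1/ q) {{ℚ.≢-nonZero q≢0}} , ℚₚ.*-inverseˡ q {{ℚ.≢-nonZero q≢0}})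

  open Criteria ℚₚ.+-*-commutativeRing fromℤ fromℤ-hom inverse (λ ()) public

  denominator-* : ∀ q → fromℤ (ℚ.↧ q) ℚ.* q ≡ fromℤ (ℚ.↥ q)
  denominator-* q@(ℚ.mkℚ n d-1 _) = ℚₚ.toℚᵘ-injective (begin
    ℚ.toℚᵘ (fromℤ (+ suc d-1) ℚ.* q)                     ≈⟨ ℚₚ.toℚᵘ-homo-* (fromℤ (+ suc d-1)) q ⟩
    ℚ.toℚᵘ (fromℤ (+ suc d-1)) ℚᵘ.* ℚᵘ.mkℚᵘ n d-1        ≈⟨ ℚᵘₚ.*-congʳ (toℚᵘ-fromℤ (+ suc d-1)) ⟩
    ℚᵘ.mkℚᵘ (+ suc d-1) 0 ℚᵘ.* ℚᵘ.mkℚᵘ n d-1             ≈⟨ ℚᵘ.*≡* cross ⟩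
    ℚᵘ.mkℚᵘ n 0                                          ≈⟨ toℚᵘ-fromℤ n ⟨
    ℚ.toℚᵘ (fromℤ n)                                     ∎)
    where
    open SetoidReasoning ℚᵘₚ.≃-setoid
    cross : + suc d-1 ℤ.* n ℤ.* + 1 ≡ n ℤ.* + (1 ℕ.* suc d-1)
    cross = ≡.trans (ℤₚ.*-identityʳ _) (≡.trans (ℤₚ.*-comm (+ suc d-1) n) (≡.cong (λ t → n ℤ.* + t) (≡.sym (ℕₚ.*-identityˡ (suc d-1)))))

  -- The common multiple is the product of all denominators: each new entry is scaled by the old
  -- product, and the old entries by the new denominator.
  integer-multiple : ∀ {n} (v : Fin n → ℚ.ℚ) →
    ∃ λ d → d ≢ + 0 × ∃ λ (x : Fin n → ℤ) → ∀ i → fromℤ (x i) ≡ fromℤ d ℚ.* v i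
  integer-multiple {zero}  v = + 1 , (λ ()) , (λ ()) , λ ()
  integer-multiple {suc n} v with integer-multiple (v ∘ suc)
  ... | d , d≢0 , x , x≡dv = ℚ.↧ v zero ℤ.* d , [ (λ ()) , d≢0 ]′ ∘ ℤₚ.i*j≡0⇒i≡0∨j≡0 (ℚ.↧ v zero) , y , y≡
    where
    open ≡.≡-Reasoning
    b : ℤ
    b = ℚ.↧ v zero
    y : Fin (suc n) → ℤ
    y zero    = d ℤ.* ℚ.↥ v zero
    y (suc i) = b ℤ.* x i
    y≡ : ∀ i → fromℤ (y i) ≡ fromℤ (b ℤ.* d) ℚ.* v i
    y≡ zero = begin
      fromℤ (d ℤ.* ℚ.↥ v zero)                  ≡⟨ fromℤ-* d (ℚ.↥ v zero) ⟩
      fromℤ d ℚ.* fromℤ (ℚ.↥ v zero)            ≡⟨ ≡.cong (fromℤ d ℚ.*_) (denominator-* (v zero)) ⟨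
      fromℤ d ℚ.* (fromℤ b ℚ.* v zero)          ≡⟨ ℚₚ.*-assoc (fromℤ d) (fromℤ b) (v zero) ⟨
      fromℤ d ℚ.* fromℤ b ℚ.* v zero            ≡⟨ ≡.cong (ℚ._* v zero) (fromℤ-* d b) ⟨
      fromℤ (d ℤ.* b) ℚ.* v zero                ≡⟨ ≡.cong (λ t → fromℤ t ℚ.* v zero) (ℤₚ.*-comm d b) ⟩
      fromℤ (b ℤ.* d) ℚ.* v zero                ∎
    y≡ (suc i) = begin
      fromℤ (b ℤ.* x i)                         ≡⟨ fromℤ-* b (x i) ⟩
      fromℤ b ℚ.* fromℤ (x i)                   ≡⟨ ≡.cong (fromℤ b ℚ.*_) (x≡dv i) ⟩
      fromℤ b ℚ.* (fromℤ d ℚ.* v (suc i))       ≡⟨ ℚₚ.*-assoc (fromℤ b) (fromℤ d) (v (suc i)) ⟨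
      fromℤ b ℚ.* fromℤ d ℚ.* v (suc i)         ≡⟨ ≡.cong (ℚ._* v (suc i)) (fromℤ-* b d) ⟨
      fromℤ (b ℤ.* d) ℚ.* v (suc i)             ∎

  clear-denominators : ∀ {n} (v : Fin n → ℚ.ℚ) →
    ∃ λ c → c ≢ ℚ.0ℚ × ∃ λ (x : Fin n → ℤ) → ∀ i → fromℤ (x i) ≡ c ℚ.* v i
  clear-denominators v with integer-multiple v
  ... | d , d≢0 , x , x≡dv = fromℤ d , d≢0 ∘ fromℤ-≡0 d , x , x≡dv

open import Data.Integer using (_-_; _^_; ∣_∣)
open import Data.Rational using (_/_)

theorem5p1 : (p : ℕ) → Prime p → (n : ℕ) → 1 ≤ n → (r r₀ : ℤ) → (+ p) ∣ (r - r₀) →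
    ((Poly.BinomIrreducible (𝔽 p) n r₀ →
    ¬ (Σ (Fin n → ℤ) λ x → (Σ (Fin n) λ i → ¬ ((+ p) ∣ x i)) × ((+ p) ∣ D r n x)))
    × (¬ (Σ (Fin n → ℤ) λ x → (Σ (Fin n) λ i → ¬ ((+ p) ∣ x i)) × ((+ p) ∣ D r n x)) →
    Poly.BinomIrreducible (𝔽 p) n r₀))
    × (Poly.BinomReducible ℚring n (r / 1) →
    Σ (Fin n → ℤ) λ x → (Σ (Fin n) λ i → x i ≢ + 0) × (D r n x ≡ + 0))
    × (2 ≤ n → (Σ ℤ λ a → (+ p) ∣ ((a ^ n) - r)) →
    Σ (Fin n → ℤ) λ x → (Σ (Fin n) λ i → x i ≢ + 0) × ((+ p) ∣ D r n x)
    × (∀ i → ∣ x i ∣ Data.Nat.^ n < p))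
theorem5p1 p p-prime (suc k) _ r r₀ r≈r₀ = (irreducible⇒ , ⇒irreducible) , reducible⇒ , root⇒
  where
  open ResidueField p p-prime
  n : ℕ
  n = suc k
  Solution : Set
  Solution = Σ (Fin n → ℤ) λ x → (Σ (Fin n) λ i → ¬ (+ p ∣ x i)) × (+ p ∣ D r n x)
  irreducible⇒ : Poly.BinomIrreducible (𝔽 p) n r₀ → ¬ Solution
  irreducible⇒ irred (x , (i , p∤xᵢ) , p∣D) =
    irreducible⇒D≉0 {k} {r} {r₀} r≈r₀ irred x (i , p∤xᵢ ∘ ≈0⇒∣ (x i)) (∣⇒≈0 (D r n x) p∣D)
  ⇒irreducible : ¬ Solution → Poly.BinomIrreducible (𝔽 p) n r₀
  ⇒irreducible unsolvable red = unsolvable (lift (reducible⇒D≈0 {k} {r} {r₀} r≈r₀ trivial-denominators red))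
    where
    lift : (∃ λ x → (∃ λ i → ¬ (x i ≈ + 0)) × D r n x ≈ + 0) → Solution
    lift (x , (i , xᵢ≉0) , D≈0) = x , (i , xᵢ≉0 ∘ ∣⇒≈0 (x i)) , ≈0⇒∣ (D r n x) D≈0
  reducible⇒ : Poly.BinomReducible ℚring n (r / 1) → Σ (Fin n → ℤ) λ x → (Σ (Fin n) λ i → x i ≢ + 0) × (D r n x ≡ + 0)
  reducible⇒ red = descend (Rationals.reducible⇒D≈0 {k} {r} ≡.refl Rationals.clear-denominators red)
    where
    open Rationals using (fromℤ; fromℤ-≡0)
    descend : (∃ λ x → (∃ λ i → fromℤ (x i) ≢ ℚ.0ℚ) × fromℤ (D r n x) ≡ ℚ.0ℚ) →
              Σ (Fin n → ℤ) λ x → (Σ (Fin n) λ i → x i ≢ + 0) × (D r n x ≡ + 0)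
    descend (x , (i , xᵢ≢0) , D≡0) = x , (i , xᵢ≢0 ∘ ≡.cong fromℤ) , fromℤ-≡0 (D r n x) D≡0
  root⇒ : 2 ≤ n → (Σ ℤ λ a → + p ∣ (a ^ n - r)) →
          Σ (Fin n → ℤ) λ x → (Σ (Fin n) λ i → x i ≢ + 0) × (+ p ∣ D r n x) × (∀ i → ∣ x i ∣ ℕ.^ n < p)
  root⇒ 2≤n (a , aⁿ≈r) = divisible (SmallSolution.smallSolution p p-prime k r a 2≤n aⁿ≈r)
    where
    divisible : (Σ (Fin n → ℤ) λ x → (Σ (Fin n) λ i → x i ≢ + 0) × (D r n x ≈ + 0) × (∀ i → ∣ x i ∣ ℕ.^ n < p)) →
                Σ (Fin n → ℤ) λ x → (Σ (Fin n) λ i → x i ≢ + 0) × (+ p ∣ D r n x) × (∀ i → ∣ x i ∣ ℕ.^ n < p)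
    divisible (x , x≢0 , D≈0 , small) = x , x≢0 , ≈0⇒∣ (D r n x) D≈0 , small
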